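{- There exists $\varepsilon>0$ such that the following holds. If $G$ is a countable $d$-regular graph and $\Delta$ is a positive integer with $\Delta < \varepsilon d$ and $h(G) > d - 3 + \frac{1}{10^7\Delta+1}$, then $G$ contains a spanning $\Delta$-ary pseudoforest $F$ that is component-wise induced, with the property that one can turn $F$ into an induced forest of $G$ by deleting one vertex from each of its components.
   Context: For a countable graph $G$, the (edge) Cheeger constant is $h(G) = \inf_X \frac{e(X, V(G)\setminus X)}{|X|}$, the infimum over all finite nonempty $X\subset V(G)$, where $e(X,Y)$ is the number of edges between $X$ and $Y$. A pseudoforest is a graph in which every connected component contains at most one cycle. A $\Delta$-ary pseudoforest is a pseudoforest in which every acyclic component is a $\Delta$-ary tree (a rooted tree in which every vertex has exactly $\Delta$ children) and every other component is $(\Delta+1)$-regular. A subgraph $F$ of $G$ is component-wise induced if each connected component of $F$ is an induced subgraph of $G$. -}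

module Defs where

open import Level using (Level; _⊔_) renaming (suc to lsuc; zero to lzero)
open import Data.Nat using (ℕ; zero; suc; _≤_; _*_; _^_)
open import Data.Integer as ℤ using (ℤ; +_)
open import Data.Rational using (ℚ; _/_; _+_; _-_)
import Data.Rational as ℚ
open import Data.List using (List; []; _∷_; _++_; [_]; length)
open import Data.List.Membership.Propositional using (_∈_; _∉_)
open import Data.List.Relation.Unary.Unique.Propositional using (Unique)
open import Data.List.Relation.Unary.Linked using (Linked)
open import Data.Product using (Σ; ∃; _×_; _,_)
open import Data.Empty using (⊥)
open import Relation.Nullary using (¬_)
open import Relation.Binary.PropositionalEquality using (_≡_)
open import Relation.Binary.Construct.Closure.ReflexiveTransitive using (Star)
open import Function.Bundles using (_⇔_)
open import Function.Definitions using (Injective)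

record Graph : Set₁ where
  field
    V        : Set
    code     : V → ℕ
    code-inj : Injective _≡_ _≡_ code
    Adj      : V → V → Set
    sym      : ∀ {u v} → Adj u v → Adj v u
    irrefl   : ∀ {v} → ¬ Adj v v
open Graph public

HasDegree : {V : Set} → (V → V → Set) → V → ℕ → Set
HasDegree {V} R v k =
  Σ (List V) λ ns → length ns ≡ k × Unique ns × (∀ w → R v w ⇔ (w ∈ ns))

Regular : Graph → ℕ → Set
Regular G d = ∀ v → HasDegree (Adj G) v d

EdgeBoundary : (G : Graph) → List (V G) → ℕ → Set
EdgeBoundary G X k =
  Σ (List (V G × V G)) λ B → length B ≡ k × Unique B ×
    (∀ x w → ((x , w) ∈ B) ⇔ (x ∈ X × w ∉ X × Adj G x w))

FiniteNonempty : (G : Graph) → List (V G) → Set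
FiniteNonempty G X = Unique X × 1 ≤ length X

fromℕ : ℕ → ℚ
fromℕ n = (+ n) / 1

-- h(G) > c, i.e. inf_X e(X,V∖X)/|X| > c : there is δ > 0 with
-- e(X,V∖X)/|X| ≥ c + δ for every finite nonempty X.
CheegerGreater : Graph → ℚ → Set
CheegerGreater G c =
  Σ ℚ λ δ → ℚ.0ℚ ℚ.< δ ×
    (∀ X k → FiniteNonempty G X → EdgeBoundary G X k →
       (c + δ) ℚ.* fromℕ (length X) ℚ.≤ fromℕ k)

record SpanningSubgraph (G : Graph) : Set₁ where
  field
    E      : V G → V G → Set
    sub    : ∀ {u v} → E u v → Adj G u v
    E-sym  : ∀ {u v} → E u v → E v u
open SpanningSubgraph public

Conn : {V : Set} → (V → V → Set) → V → V → Set
Conn R = Star R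

record Cycle {V : Set} (R : V → V → Set) : Set where
  constructor cycle
  field
    start   : V
    rest    : List V
    long    : 2 ≤ length rest
    distinct : Unique (start ∷ rest)
    closed  : Linked R (start ∷ rest ++ [ start ])
open Cycle public

OnCycle : {V : Set} {R : V → V → Set} → Cycle R → V → Set
OnCycle c v = v ∈ (start c ∷ rest c)

data Consec {V : Set} : List V → V → V → Set where
  here  : ∀ {a b xs} → Consec (a ∷ b ∷ xs) a b
  there : ∀ {x xs a b} → Consec xs a b → Consec (x ∷ xs) a b

CycleEdge : {V : Set} {R : V → V → Set} → Cycle R → V → V → Set
CycleEdge c a b = let w = start c ∷ rest c ++ [ start c ] in
  Consec w a b Data.Sum.⊎ Consec w b a
  where import Data.Sum

SameCycle : {V : Set} {R : V → V → Set} → Cycle R → Cycle R → Set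
SameCycle c₁ c₂ = ∀ a b → CycleEdge c₁ a b ⇔ CycleEdge c₂ a b

Pseudoforest : {V : Set} → (V → V → Set) → Set
Pseudoforest R = ∀ (c₁ c₂ : Cycle R) u v → OnCycle c₁ u → OnCycle c₂ v →
  Conn R u v → SameCycle c₁ c₂

AcyclicComponent : {V : Set} → (V → V → Set) → V → Set
AcyclicComponent R v = ∀ (c : Cycle R) u → OnCycle c u → ¬ Conn R v u

CyclicComponent : {V : Set} → (V → V → Set) → V → Set
CyclicComponent R v = Σ (Cycle R) λ c → ∃ λ u → OnCycle c u × Conn R v u

Walk : {V : Set} → (V → V → Set) → V → V → ℕ → Set
Walk R u v zero = u ≡ v
Walk R u v (suc n) = ∃ λ w → R u w × Walk R w v n

Dist : {V : Set} → (V → V → Set) → V → V → ℕ → Set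
Dist R u v n = Walk R u v n × (∀ m → Walk R u v m → n ≤ m)

Child : {V : Set} → (V → V → Set) → V → V → V → Set
Child R r v w = R v w × ∃ λ n → Dist R r v n × Dist R r w (suc n)

DeltaAryTreeComponent : {V : Set} → (V → V → Set) → ℕ → V → Set
DeltaAryTreeComponent {V} R Δ v =
  Σ V λ r → Conn R v r × (∀ u → Conn R v u → HasDegree (Child R r) u Δ)

DeltaAryPseudoforest : {V : Set} → (V → V → Set) → ℕ → Set
DeltaAryPseudoforest R Δ = Pseudoforest R ×
  (∀ v → (AcyclicComponent R v → DeltaAryTreeComponent R Δ v) ×
         (CyclicComponent R v → ∀ u → Conn R v u → HasDegree R u (suc Δ)))

ComponentwiseInduced : (G : Graph) → SpanningSubgraph G → Set
ComponentwiseInduced G F = ∀ u v → Conn (E F) u v → Adj G u v → E F u v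

-- deleting one vertex from each component of F yields an induced forest of G:
-- a set S meeting every component of F in exactly one vertex, such that
-- F - S has no cycles and F - S = G[V ∖ S].
DeleteOnePerComponentInducedForest : (G : Graph) → SpanningSubgraph G → Set₁
DeleteOnePerComponentInducedForest G F =
  Σ (V G → Set) λ S →
    (∀ v → ∃ λ s → S s × Conn (E F) v s) ×
    (∀ s s' → S s → S s' → Conn (E F) s s' → s ≡ s') ×
    (∀ u v → ¬ S u → ¬ S v → Adj G u v → E F u v) ×
    (∀ (c : Cycle (E F)) → ∃ λ s → S s × OnCycle c s)

-- The Cheeger bound says that every finite set X spans at most 3|X|/2 edges. Let each edge demand a
-- slot at one of its ends and let each vertex w make Δ + 14 further demands for slots at its
-- neighbours; every vertex offers two slots. Since d is large compared with Δ, any finite set of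
-- demands sees 8/7 times as many slots, and in such an expanding bipartite graph all demands can be
-- matched to distinct slots, one demand at a time (Kierstead). If an edge xw and a further demand of w share the
-- vertex x, then x is a kid of w: it owns no other edge, so two adjacent kids are parent and kid.
--
-- The ancestor chains of the kid relation may be infinite. They are cut by a rank: at time t a vertex
-- is ripe if its descendants of code < t, weighted by 2^-depth, sum to at least 1, and its rank is the
-- first such time. Only one vertex appears at each time, so at most 8 kids of w have rank ≤ rank w.
-- Vertex w adopts Δ of its kids of larger rank that are not adjacent to the root of w. The resulting
-- forest consists of Δ-ary trees, and deleting their roots leaves an induced forest.

module Submission where

open import Defs

-- The graph is infinite and the construction is effective, so each choice must be read off finite
-- data. For the matching this is where strict expansion helps: a set that a bad choice leaves short
-- of slots has at most 7 times as many demands as there are stages behind it, so a finite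
-- neighbourhood of the new demand reveals it. Hall's condition alone gives no such bound.
--
-- For the rank, the order by `code` would be useless, as all kids of a vertex may precede it. With
-- weights 2^-depth a ripe kid contributes about 1/2 to its owner, so an owner that is not yet ripe
-- has few ripe kids, and a single new vertex changes a weight by less than 2.
--
-- The 14 extra requests are the losses per vertex `w`: 8 kids of small rank, 2 kids adjacent to the
-- root (their edges to the root fill the two slots of the root), and 4 requests that land on a
-- neighbour `x` whose edge to `w` sits at `w` and not at `x`.

module Pseudoforests where

  open import Data.Bool using (Bool; true; false)
  open import Data.Bool.Properties using () renaming (_≟_ to _≟ᵇ_)
  open import Data.Fin using (Fin; toℕ)
  open import Data.Fin.Properties using (toℕ-injective) renaming (_≟_ to _≟ᶠ_; any? to anyFin?)
  open import Data.List using (List; []; _∷_; [_]; _++_; length; filter; map; concatMap; deduplicate; take; upTo; allFin; cartesianProduct)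
  open import Data.List.Membership.Propositional using (_∈_; _∉_; find; lose)
  open import Data.List.Membership.Propositional.Properties
    using (∈-++⁺ˡ; ∈-++⁺ʳ; ∈-++⁻; ∈-map⁺; ∈-map⁻; ∈-concatMap⁺; ∈-concatMap⁻; ∈-filter⁺; ∈-filter⁻;
           ∈-deduplicate⁺; ∈-deduplicate⁻; ∈-upTo⁺; ∈-allFin; ∈-cartesianProduct⁺; ∈-∃++)
  open import Data.List.Properties
    using (length-++; length-map; length-filter; length-take; length-upTo; length-tabulate; filter-++; filter-some; filter-none)
  open import Data.List.Relation.Unary.All as All using (All; []; _∷_)
  open import Data.List.Relation.Unary.AllPairs using ([]; _∷_)
  open import Data.List.Relation.Unary.Any using (here; there; any?)
  open import Data.List.Relation.Unary.Linked using (Linked; _∷_)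
  open import Data.List.Relation.Unary.Unique.DecPropositional.Properties using (deduplicate-!)
  open import Data.List.Relation.Unary.Unique.Propositional using (Unique)
  open import Data.List.Relation.Unary.Unique.Propositional.Properties using (map⁺; ++⁺; filter⁺; take⁺; allFin⁺)
  open import Data.Maybe using (Maybe; just; nothing)
  open import Data.Maybe.Properties using (just-injective) renaming (≡-dec to maybe-≡-dec)
  open import Data.Nat using (ℕ; zero; suc; _+_; _*_; _^_; _≤_; _<_; z≤n; s≤s; _≟_; _<?_; _≤?_)
  open import Data.Nat.Induction using (<-wellFounded; Acc; acc)
  open import Data.Nat.ListAction using (sum)
  open import Data.Nat.Properties hiding (_≟_; _<?_; _≤?_)
  open import Data.Nat.Tactic.RingSolver using (solve-∀)
  open import Data.Product using (Σ; ∃; _×_; _,_; proj₁; proj₂; swap)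
  open import Data.Product.Properties using () renaming (≡-dec to pair-≡-dec)
  open import Data.Sum using (_⊎_; inj₁; inj₂) renaming (swap to ⊎-swap)
  open import Data.Sum.Properties using (inj₁-injective) renaming (≡-dec to sum-≡-dec)
  open import Data.Unit using (⊤; tt)
  open import Function using (_∘_; id; case_of_)
  open import Function.Bundles using (_⇔_; mk⇔; Equivalence)
  open import Relation.Binary.Construct.Closure.ReflexiveTransitive using (Star; ε; _◅_)
  open import Relation.Binary.Definitions using (DecidableEquality)
  open import Relation.Binary.PropositionalEquality using (_≡_; _≢_; refl; cong; cong₂; subst; subst₂) renaming (sym to ≡-sym; trans to ≡-trans)
  open import Relation.Nullary using (¬_; Dec; yes; no; contradiction)
  open import Relation.Nullary.Decidable using (¬?; _×-dec_; _⊎-dec_; map′; decidable-stable; ¬¬-excluded-middle)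
  open import Relation.Unary using (Decidable)
  import Data.List.Membership.DecPropositional as DecMembership

  -- Finite lists

  private variable
    A B : Set

  -- Pigeonhole for a relation instead of a function: callers have witnesses only for members of
  -- `xs`, and injectivity becomes a property of the relation alone. The witness of the head is cut
  -- out of `ys`; by injectivity no later element needs it.
  length-injection : (Rel : A → B → Set) → (∀ {x x' y} → Rel x y → Rel x' y → x ≡ x') →
    ∀ xs (ys : List B) → Unique xs → (∀ {x} → x ∈ xs → ∃ λ y → y ∈ ys × Rel x y) →
    length xs ≤ length ys
  length-injection Rel inj [] ys u f = z≤n
  length-injection {B = B} Rel inj (x ∷ xs) ys (x∉ ∷ u) f with f (here refl)
  ... | y , y∈ , xRy with ∈-∃++ y∈
  ... | as , bs , refl = subst (suc (length xs) ≤_) (≡-sym len) (s≤s (length-injection Rel inj xs (as ++ bs) u f'))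
    where
    len : length (as ++ y ∷ bs) ≡ suc (length (as ++ bs))
    len = ≡-trans (length-++ as) (≡-trans (+-suc (length as) (length bs)) (cong suc (≡-sym (length-++ as))))
    f' : ∀ {x'} → x' ∈ xs → ∃ λ y' → y' ∈ as ++ bs × Rel x' y'
    f' x'∈ with f (there x'∈)
    ... | y' , y'∈ , x'Ry' with ∈-++⁻ as y'∈
    ... | inj₁ p = y' , ∈-++⁺ˡ p , x'Ry'
    ... | inj₂ (here refl) = contradiction (inj xRy x'Ry') (All.lookup x∉ x'∈)
    ... | inj₂ (there p) = y' , ∈-++⁺ʳ as p , x'Ry'

  length-⊆ : (xs ys : List A) → Unique xs → (∀ {x} → x ∈ xs → x ∈ ys) → length xs ≤ length ys
  length-⊆ xs ys u s = length-injection _≡_ (λ { refl refl → refl }) xs ys u λ x∈ → _ , s x∈ , refl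

  length-bounded : (Rel : A → ℕ → Set) → (∀ {x x' k} → Rel x k → Rel x' k → x ≡ x') →
    ∀ n xs → Unique xs → (∀ {x} → x ∈ xs → ∃ λ k → k < n × Rel x k) → length xs ≤ n
  length-bounded Rel inj n xs u f = subst (length xs ≤_) (length-upTo n)
    (length-injection Rel inj xs (upTo n) u λ x∈ → let k , k< , r = f x∈ in k , ∈-upTo⁺ k< , r)

  module _ {P : A → Set} (P? : Decidable P) where

    length-split : ∀ xs → length xs ≡ length (filter P? xs) + length (filter (¬? ∘ P?) xs)
    length-split [] = refl
    length-split (x ∷ xs) with P? x
    ... | yes _ = cong suc (length-split xs)
    ... | no _ = ≡-trans (cong suc (length-split xs)) (≡-sym (+-suc _ _))

  module _ {P Q : A → Set} (P? : Decidable P) (Q? : Decidable Q) (P⇒Q : ∀ {x} → P x → Q x) where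

    length-filter-mono : ∀ xs → length (filter P? xs) ≤ length (filter Q? xs)
    length-filter-mono [] = z≤n
    length-filter-mono (x ∷ xs) with P? x | Q? x
    ... | yes p | yes q = s≤s (length-filter-mono xs)
    ... | yes p | no ¬q = contradiction (P⇒Q p) ¬q
    ... | no ¬p | yes q = m≤n⇒m≤1+n (length-filter-mono xs)
    ... | no ¬p | no ¬q = length-filter-mono xs

    length-filter-strict : ∀ {x} xs → x ∈ xs → Q x → ¬ P x → length (filter P? xs) < length (filter Q? xs)
    length-filter-strict (x ∷ xs) (here refl) q ¬p with P? x | Q? x
    ... | yes p | _ = contradiction p ¬p
    ... | no _ | yes _ = s≤s (length-filter-mono xs)
    ... | no _ | no ¬q = contradiction q ¬q
    length-filter-strict (x ∷ xs) (there x∈) q ¬p with P? x | Q? x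
    ... | yes p | yes _ = s≤s (length-filter-strict xs x∈ q ¬p)
    ... | yes p | no ¬q = contradiction (P⇒Q p) ¬q
    ... | no _ | yes _ = m≤n⇒m≤1+n (length-filter-strict xs x∈ q ¬p)
    ... | no _ | no _ = length-filter-strict xs x∈ q ¬p

  -- A finite power set: it makes the search for a deficient set of demands decidable.
  sublists : List A → List (List A)
  sublists [] = [] ∷ []
  sublists (x ∷ xs) = map (x ∷_) (sublists xs) ++ sublists xs

  module _ {P : A → Set} (P? : Decidable P) where

    filter∈sublists : ∀ xs → filter P? xs ∈ sublists xs
    filter∈sublists [] = here refl
    filter∈sublists (x ∷ xs) with P? x
    ... | yes _ = ∈-++⁺ˡ (∈-map⁺ (x ∷_) (filter∈sublists xs))
    ... | no _ = ∈-++⁺ʳ (map (x ∷_) (sublists xs)) (filter∈sublists xs)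

  sublists-⊆ : ∀ (xs : List A) {ys} → ys ∈ sublists xs → ∀ {y} → y ∈ ys → y ∈ xs
  sublists-⊆ [] (here refl) ()
  sublists-⊆ (x ∷ xs) s y∈ with ∈-++⁻ (map (x ∷_) (sublists xs)) s
  ... | inj₂ s' = there (sublists-⊆ xs s' y∈)
  ... | inj₁ s' with ∈-map⁻ (x ∷_) s'
  sublists-⊆ (x ∷ xs) s (here refl) | inj₁ s' | zs , zs∈ , refl = here refl
  sublists-⊆ (x ∷ xs) s (there y∈) | inj₁ s' | zs , zs∈ , refl = there (sublists-⊆ xs zs∈ y∈)

  sublists-unique : ∀ (xs : List A) {ys} → Unique xs → ys ∈ sublists xs → Unique ys
  sublists-unique [] u (here refl) = []
  sublists-unique (x ∷ xs) (x∉ ∷ u) s with ∈-++⁻ (map (x ∷_) (sublists xs)) s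
  ... | inj₂ s' = sublists-unique xs u s'
  ... | inj₁ s' with ∈-map⁻ (x ∷_) s'
  ... | zs , zs∈ , refl = All.tabulate (λ y∈ → All.lookup x∉ (sublists-⊆ xs zs∈ y∈)) ∷ sublists-unique xs u zs∈

  ∈-concatMap : (f : A → List B) → ∀ {x xs y} → x ∈ xs → y ∈ f x → y ∈ concatMap f xs
  ∈-concatMap f x∈ y∈ = ∈-concatMap⁺ f (lose x∈ y∈)

  ∈-concatMap-find : (f : A → List B) → ∀ xs {y} → y ∈ concatMap f xs → ∃ λ x → x ∈ xs × y ∈ f x
  ∈-concatMap-find f xs y∈ = find (∈-concatMap⁻ f {xs = xs} y∈)

  concatMap-unique : (f : A → List B) → ∀ xs → Unique xs → (∀ {x} → x ∈ xs → Unique (f x)) →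
    (∀ {x x' y} → y ∈ f x → y ∈ f x' → x ≡ x') → Unique (concatMap f xs)
  concatMap-unique f [] u uf dis = []
  concatMap-unique f (x ∷ xs) (x∉ ∷ u) uf dis =
    ++⁺ (uf (here refl)) (concatMap-unique f xs u (uf ∘ there) dis) disjoint
    where
    disjoint : ∀ {y} → ¬ (y ∈ f x × y ∈ concatMap f xs)
    disjoint (p , q) with ∈-concatMap-find f xs q
    ... | x' , x'∈ , q' = All.lookup x∉ x'∈ (dis p q')

  module _ {P Q : A → Set} (P? : Decidable P) (Q? : Decidable Q) (P⇒Q : ∀ {x} → P x → Q x)
    (gap : ∀ {x y} → Q x → ¬ P x → Q y → ¬ P y → x ≡ y) where

    length-filter-gap : ∀ xs → Unique xs → length (filter Q? xs) ≤ suc (length (filter P? xs))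
    length-filter-gap [] [] = z≤n
    length-filter-gap (x ∷ xs) (x∉ ∷ u) with P? x | Q? x
    ... | yes p | no ¬q = contradiction (P⇒Q p) ¬q
    ... | yes p | yes q = s≤s (length-filter-gap xs u)
    ... | no ¬p | no ¬q = length-filter-gap xs u
    ... | no ¬p | yes q = s≤s (no-gap xs x∉)
      where
      no-gap : ∀ ys → All (x ≢_) ys → length (filter Q? ys) ≤ length (filter P? ys)
      no-gap [] [] = z≤n
      no-gap (y ∷ ys) (x≢y ∷ al) with P? y | Q? y
      ... | yes p' | no ¬q' = contradiction (P⇒Q p') ¬q'
      ... | yes _ | yes _ = s≤s (no-gap ys al)
      ... | no _ | no _ = no-gap ys al
      ... | no ¬p' | yes q' = contradiction (gap q ¬p q' ¬p') x≢y

  module _ {P Q S : A → Set} (P? : Decidable P) (Q? : Decidable Q) (S? : Decidable S)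
    (cover : ∀ x → P x ⊎ Q x ⊎ S x) where

    length-cover : ∀ xs → length xs ≤ length (filter P? xs) + (length (filter Q? xs) + length (filter S? xs))
    length-cover xs = begin
      length xs ≡⟨ length-split P? xs ⟩
      length (filter P? xs) + length (filter (¬? ∘ P?) xs) ≤⟨ +-monoʳ-≤ (length (filter P? xs)) (others xs) ⟩
      length (filter P? xs) + (length (filter Q? xs) + length (filter S? xs)) ∎
      where
      open ≤-Reasoning
      others : ∀ xs → length (filter (¬? ∘ P?) xs) ≤ length (filter Q? xs) + length (filter S? xs)
      others [] = z≤n
      others (x ∷ xs) with P? x | Q? x | S? x
      ... | yes _ | yes _ | yes _ = ≤-trans (others xs) (+-mono-≤ (n≤1+n _) (n≤1+n _))
      ... | yes _ | yes _ | no _ = ≤-trans (others xs) (n≤1+n _)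
      ... | yes _ | no _ | yes _ = ≤-trans (others xs) (+-monoʳ-≤ (length (filter Q? xs)) (n≤1+n _))
      ... | yes _ | no _ | no _ = others xs
      ... | no _ | yes _ | yes _ = s≤s (≤-trans (others xs) (+-monoʳ-≤ (length (filter Q? xs)) (n≤1+n _)))
      ... | no _ | yes _ | no _ = s≤s (others xs)
      ... | no _ | no _ | yes _ = ≤-trans (s≤s (others xs)) (≤-reflexive (≡-sym (+-suc _ _)))
      ... | no ¬p | no ¬q | no ¬s with cover x
      ... | inj₁ p = contradiction p ¬p
      ... | inj₂ (inj₁ q) = contradiction q ¬q
      ... | inj₂ (inj₂ s) = contradiction s ¬s

  -- Matchings in expanding bipartite graphs

  module ExpandingMatching
    {L R : Set} (_≟L_ : DecidableEquality L) (_≟R_ : DecidableEquality R)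
    (code : L → ℕ) (code-inj : ∀ {l l'} → code l ≡ code l' → l ≡ l')
    (Dom : L → Set) (Dom? : Decidable Dom)
    (nb : L → List R) (inv : R → List L)
    (inv-complete : ∀ {l r} → Dom l → r ∈ nb l → l ∈ inv r)
    (c : ℕ)
    (expand : ∀ X Y → Unique X → All Dom X → (∀ {l r} → l ∈ X → r ∈ nb l → r ∈ Y) →
              suc c * length X ≤ c * length Y)
    where

    open DecMembership _≟L_ using () renaming (_∈?_ to _∈L?_)
    open DecMembership _≟R_ using () renaming (_∈?_ to _∈R?_)

    Used : (L → Maybe R) → R → Set
    Used m r = ∃ λ l → m l ≡ just r

    Free : ℕ → L → Set
    Free n l = Dom l × n ≤ code l

    Covers : (L → Maybe R) → List L → List R → Set
    Covers m X Y = ∀ {l r} → l ∈ X → r ∈ nb l → r ∈ Y ⊎ Used m r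

    record Stage (n : ℕ) : Set where
      field
        match   : L → Maybe R
        sound   : ∀ {l r} → match l ≡ just r → Dom l × code l < n × r ∈ nb l
        unique  : ∀ {l l' r} → match l ≡ just r → match l' ≡ just r → l ≡ l'
        total   : ∀ {l} → Dom l → code l < n → ∃ λ r → match l ≡ just r
        hall    : ∀ X Y → Unique X → All (Free n) X → Covers match X Y → length X ≤ length Y

    ball : ℕ → L → List L
    ball zero l = [ l ]
    ball (suc i) l = ball i l ++ concatMap (concatMap inv ∘ nb) (ball i l)

    ball-centre : ∀ i l → l ∈ ball i l
    ball-centre zero l = here refl
    ball-centre (suc i) l = ∈-++⁺ˡ (ball-centre i l)

    ball-step : ∀ i l {x y r} → x ∈ ball i l → r ∈ nb x → Dom y → r ∈ nb y → y ∈ ball (suc i) l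
    ball-step i l x∈ r∈ d r∈' = ∈-++⁺ʳ (ball i l)
      (∈-concatMap (concatMap inv ∘ nb) x∈ (∈-concatMap inv r∈ (inv-complete d r∈')))

    ball-mono : ∀ i j l {x} → i ≤ j → x ∈ ball i l → x ∈ ball j l
    ball-mono zero zero l z≤n x∈ = x∈
    ball-mono zero (suc j) l z≤n x∈ = ∈-++⁺ˡ (ball-mono zero j l z≤n x∈)
    ball-mono (suc i) (suc j) l (s≤s le) x∈ with ∈-++⁻ (ball i l) x∈
    ... | inj₁ p = ∈-++⁺ˡ (ball-mono i j l le p)
    ... | inj₂ q with ∈-concatMap-find (concatMap inv ∘ nb) (ball i l) q
    ... | z , z∈ , q' = ∈-++⁺ʳ (ball j l) (∈-concatMap _ (ball-mono i j l le z∈) q')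

    -- The shells ball (j + 1) ∖ ball j are disjoint, so a set misses one of the first |X| + 1 of them.
    empty-shell : ∀ l X n → (∃ λ j → j < n × (∀ {x} → x ∈ X → x ∈ ball (suc j) l → x ∈ ball j l))
      ⊎ n ≤ length (filter (_∈L? ball n l) X)
    empty-shell l X zero = inj₂ z≤n
    empty-shell l X (suc n) with empty-shell l X n
    ... | inj₁ (j , j< , p) = inj₁ (j , m≤n⇒m≤1+n j< , p)
    ... | inj₂ le with any? (λ x → (x ∈L? ball (suc n) l) ×-dec ¬? (x ∈L? ball n l)) X
    ... | no none = inj₁ (n , ≤-refl , λ {x} x∈ x∈' → decidable-stable (x ∈L? ball n l) λ x∉ → none (lose x∈ (x∈' , x∉)))
    ... | yes some with find some
    ... | x , x∈ , x∈' , x∉ = inj₂ (≤-trans (s≤s le)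
          (length-filter-strict (_∈L? ball n l) (_∈L? ball (suc n) l) ∈-++⁺ˡ X x∈ x∈' x∉))

    module Extend {n : ℕ} (st : Stage n) where
      open Stage st

      -- A demand matched to `r` must occur in the finite list `inv r`, so the existential over all
      -- demands reduces to a search.
      Used? : Decidable (Used match)
      Used? r = map′ (λ a → let l , _ , e = find a in l , e)
        (λ { (l , e) → let d , _ , r∈ = sound e in lose (inv-complete d r∈) e })
        (any? (λ l → maybe-≡-dec _≟R_ (match l) (just r)) (inv r))

      module Choice (l : L) (dl : Dom l) (cl : code l ≡ n) where

        free? : Decidable (Free (suc n))
        free? x = Dom? x ×-dec (suc n ≤? code x)

        -- The radius is chosen for `safe`: a violating set has at most `c * n` elements, so it
        -- misses one of the `suc (c * n)` shells inside this ball, and its part within that shell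
        -- is made of members of the pool.
        pool : List L
        pool = filter free? (deduplicate _≟L_ (ball (suc (c * n)) l))

        pool-unique : Unique pool
        pool-unique = filter⁺ free? (deduplicate-! _≟L_ (ball (suc (c * n)) l))

        remaining? : ∀ r → Decidable (λ r' → ¬ (Used match r') × r' ≢ r)
        remaining? r r' = ¬? (Used? r') ×-dec ¬? (r' ≟R r)

        remaining : R → List L → List R
        remaining r X = filter (remaining? r) (deduplicate _≟R_ (concatMap nb X))

        Deficient : R → List L → Set
        Deficient r X = length (remaining r X) < length X

        deficient? : ∀ r → Dec (∃ λ X → X ∈ sublists pool × Deficient r X)
        deficient? r = map′ find (λ { (_ , X∈ , p) → lose X∈ p })
          (any? (λ X → length (remaining r X) <? length X) (sublists pool))

        Good : R → Set
        Good r = ¬ Used match r × ¬ ∃ λ X → X ∈ sublists pool × Deficient r X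

        good? : Decidable Good
        good? r = ¬? (Used? r) ×-dec ¬? (deficient? r)

        record Tight (rs : List R) : Set where
          field
            X : List L
            Z : List R
            X-unique : Unique X
            X-free : All (Free (suc n)) X
            covers : Covers match X Z
            tight : length Z ≤ length X
            includes : ∀ {r} → r ∈ rs → r ∈ Z ⊎ Used match r

        weaken : ∀ {x} → Free (suc n) x → Free n x
        weaken (d , le) = d , ≤-trans (n≤1+n n) le

        free-pool : ∀ {X} → X ∈ sublists pool → All (Free (suc n)) X
        free-pool X∈ = All.tabulate λ x∈ → proj₂ (∈-filter⁻ free? {xs = deduplicate _≟L_ (ball (suc (c * n)) l)} (sublists-⊆ pool X∈ x∈))

        remaining-covers : ∀ r {X l' r'} → l' ∈ X → r' ∈ nb l' → r' ∈ r ∷ remaining r X ⊎ Used match r'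
        remaining-covers r {X} {l'} {r'} l∈ r∈ with Used? r' | r' ≟R r
        ... | yes u | _ = inj₂ u
        ... | no _ | yes refl = inj₁ (here refl)
        ... | no ¬u | no ≢r = inj₁ (there (∈-filter⁺ (remaining? r)
                (∈-deduplicate⁺ _≟R_ (∈-concatMap nb l∈ r∈)) (¬u , ≢r)))

        -- Tight sets are closed under union: by submodularity, with `hall` applied to the intersection.
        unite : ∀ {r rs} X → X ∈ sublists pool → Deficient r X → Tight rs → Tight (r ∷ rs)
        unite {r} X₁ X₁∈ def t = record
          { X = X ++ filter (∉X? X) X₁
          ; Z = Z ++ filter (∉Z? Z) Z₁
          ; X-unique = ++⁺ X-unique (filter⁺ (∉X? X) uX₁) λ { (p , q) → proj₂ (∈-filter⁻ (∉X? X) {xs = X₁} q) p }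
          ; X-free = All.tabulate λ x∈ → case ∈-++⁻ X x∈ of λ
              { (inj₁ p) → All.lookup X-free p
              ; (inj₂ q) → All.lookup (free-pool X₁∈) (proj₁ (∈-filter⁻ (∉X? X) {xs = X₁} q)) }
          ; covers = λ l∈ r∈ → case ∈-++⁻ X l∈ of λ
              { (inj₁ p) → inZ (covers p r∈)
              ; (inj₂ q) → inZ₁ (remaining-covers r (proj₁ (∈-filter⁻ (∉X? X) {xs = X₁} q)) r∈) }
          ; tight = tight'
          ; includes = λ { (here refl) → inZ₁ (inj₁ (here refl)) ; (there p) → inZ (includes p) }
          }
          where
          open Tight t
          Z₁ = r ∷ remaining r X₁
          ∉X? : ∀ X → Decidable (_∉ X)
          ∉X? X = ¬? ∘ (_∈L? X)
          ∉Z? : ∀ Z → Decidable (_∉ Z)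
          ∉Z? Z = ¬? ∘ (_∈R? Z)
          uX₁ = sublists-unique pool pool-unique X₁∈
          inZ : ∀ {r'} → r' ∈ Z ⊎ Used match r' → r' ∈ Z ++ filter (∉Z? Z) Z₁ ⊎ Used match r'
          inZ (inj₁ p) = inj₁ (∈-++⁺ˡ p)
          inZ (inj₂ u) = inj₂ u
          inZ₁ : ∀ {r'} → r' ∈ Z₁ ⊎ Used match r' → r' ∈ Z ++ filter (∉Z? Z) Z₁ ⊎ Used match r'
          inZ₁ (inj₂ u) = inj₂ u
          inZ₁ {r'} (inj₁ p) with r' ∈R? Z
          ... | yes q = inj₁ (∈-++⁺ˡ q)
          ... | no q = inj₁ (∈-++⁺ʳ Z (∈-filter⁺ (∉Z? Z) p q))
          meet : length (filter (_∈L? X) X₁) ≤ length (filter (_∈R? Z) Z₁)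
          meet = hall _ _ (filter⁺ (_∈L? X) uX₁)
            (All.tabulate λ x∈ → weaken (All.lookup X-free (proj₂ (∈-filter⁻ (_∈L? X) {xs = X₁} x∈))))
            λ l∈ r∈ → let p , q = ∈-filter⁻ (_∈L? X) {xs = X₁} l∈ in
              case covers q r∈ of λ
                { (inj₂ u) → inj₂ u
                ; (inj₁ a) → case remaining-covers r p r∈ of λ
                   { (inj₂ u) → inj₂ u ; (inj₁ b) → inj₁ (∈-filter⁺ (_∈R? Z) b a) } }
          tight' : length (Z ++ filter (∉Z? Z) Z₁) ≤ length (X ++ filter (∉X? X) X₁)
          tight' = +-cancelˡ-≤ (length (filter (_∈R? Z) Z₁)) _ _ (begin
            zi + length (Z ++ filter (∉Z? Z) Z₁) ≡⟨ cong (zi +_) (length-++ Z) ⟩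
            zi + (length Z + zo) ≡⟨ cong (zi +_) (+-comm (length Z) zo) ⟩
            zi + (zo + length Z) ≡⟨ ≡-sym (+-assoc zi zo _) ⟩
            (zi + zo) + length Z ≡⟨ cong (_+ length Z) (≡-sym (length-split (_∈R? Z) Z₁)) ⟩
            length Z₁ + length Z ≤⟨ +-mono-≤ def tight ⟩
            length X₁ + length X ≡⟨ cong (_+ length X) (length-split (_∈L? X) X₁) ⟩
            (xi + xo) + length X ≡⟨ +-assoc xi xo _ ⟩
            xi + (xo + length X) ≤⟨ +-monoˡ-≤ _ meet ⟩
            zi + (xo + length X) ≡⟨ cong (zi +_) (+-comm xo (length X)) ⟩
            zi + (length X + xo) ≡⟨ cong (zi +_) (≡-sym (length-++ X)) ⟩
            zi + length (X ++ filter (∉X? X) X₁) ∎)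
            where
            open ≤-Reasoning
            zi = length (filter (_∈R? Z) Z₁)
            zo = length (filter (∉Z? Z) Z₁)
            xi = length (filter (_∈L? X) X₁)
            xo = length (filter (∉X? X) X₁)

        unite-used : ∀ {r rs} → Used match r → Tight rs → Tight (r ∷ rs)
        unite-used u t = record
          { X = X ; Z = Z ; X-unique = X-unique ; X-free = X-free ; covers = covers ; tight = tight
          ; includes = λ { (here refl) → inj₂ u ; (there p) → includes p } }
          where open Tight t

        tight-family : ∀ rs → (∀ {r} → r ∈ rs → ¬ Good r) → Tight rs
        tight-family [] _ = record
          { X = [] ; Z = [] ; X-unique = [] ; X-free = [] ; covers = λ () ; tight = z≤n ; includes = λ () }
        tight-family (r ∷ rs) bad with Used? r | deficient? r
        ... | yes u | _ = unite-used u (tight-family rs (bad ∘ there))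
        ... | no _ | yes (X , X∈ , def) = unite X X∈ def (tight-family rs (bad ∘ there))
        ... | no ¬u | no ¬def = contradiction (¬u , ¬def) (bad (here refl))

        -- If every slot of `l` were bad, the tight set accounting for all of them, enlarged by `l`,
        -- would need one slot more than `Z` has, against `hall`.
        chosen : ∃ λ r → r ∈ nb l × Good r
        chosen with any? good? (nb l)
        ... | yes some = find some
        ... | no none = contradiction (≤-trans over tight) (<-irrefl refl)
          where
          open Tight (tight-family (nb l) (λ r∈ g → none (lose r∈ g)))
          over : suc (length X) ≤ length Z
          over = hall (l ∷ X) Z
            (All.tabulate (λ x∈ → λ { refl → <-irrefl (≡-sym cl) (proj₂ (All.lookup X-free x∈)) }) ∷ X-unique)
            ((dl , ≤-reflexive (≡-sym cl)) ∷ All.map weaken X-free)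
            λ { (here refl) r∈ → includes r∈ ; (there p) r∈ → covers p r∈ }

        value : R
        value = proj₁ chosen

        used-bound : ∀ U → Unique U → All (Used match) U → length U ≤ n
        used-bound U u used = length-bounded (λ r k → ∃ λ l' → match l' ≡ just r × code l' ≡ k)
          (λ { (l₁ , e₁ , k₁) (l₂ , e₂ , k₂) → just-injective
                 (≡-trans (≡-sym e₁) (≡-trans (cong match (code-inj (≡-trans k₁ (≡-sym k₂)))) e₂)) })
          n U u λ r∈ → let l' , e = All.lookup used r∈ in code l' , proj₁ (proj₂ (sound e)) , l' , e , refl

        -- A set short of slots is small: at most `n` slots are used, so expansion forces
        -- `length X ≤ c * n`, and the set misses a shell around `l`. The part within the shell was
        -- tested when `value` was chosen; the part beyond does not see `value` and obeys the old
        -- `hall`; the two parts share no slot.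
        safe : ∀ X Y → Unique X → All (Free (suc n)) X →
          (∀ {l' r'} → l' ∈ X → r' ∈ nb l' → r' ∈ Y ⊎ Used match r' ⊎ r' ≡ value) → length X ≤ length Y
        safe X Y uX fX cov with length X ≤? length Y
        ... | yes le = le
        ... | no ¬le = split-case (empty-shell l X (suc (c * n)))
          where
          Y<X : length Y < length X
          Y<X = ≰⇒> ¬le
          U = filter Used? (deduplicate _≟R_ (concatMap nb X))
          U≤n : length U ≤ n
          U≤n = used-bound U (filter⁺ Used? (deduplicate-! _≟R_ (concatMap nb X)))
            (All.tabulate λ r∈ → proj₂ (∈-filter⁻ Used? {xs = deduplicate _≟R_ (concatMap nb X)} r∈))
          expanded : suc c * length X ≤ c * length (value ∷ Y ++ U)
          expanded = expand X (value ∷ Y ++ U) uX (All.map proj₁ fX) λ l∈ r∈ → case cov l∈ r∈ of λ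
            { (inj₁ p) → there (∈-++⁺ˡ p)
            ; (inj₂ (inj₁ u)) → there (∈-++⁺ʳ Y (∈-filter⁺ Used? (∈-deduplicate⁺ _≟R_ (∈-concatMap nb l∈ r∈)) u))
            ; (inj₂ (inj₂ refl)) → here refl }
          small : length X ≤ c * n
          small = +-cancelʳ-≤ (c * length X) _ _ (begin
            length X + c * length X ≤⟨ expanded ⟩
            c * suc (length (Y ++ U)) ≡⟨ cong (λ z → c * suc z) (length-++ Y) ⟩
            c * (suc (length Y) + length U) ≤⟨ *-monoʳ-≤ c (+-mono-≤ Y<X U≤n) ⟩
            c * (length X + n) ≡⟨ cong (c *_) (+-comm (length X) n) ⟩
            c * (n + length X) ≡⟨ *-distribˡ-+ c n _ ⟩
            c * n + c * length X ∎)
            where open ≤-Reasoning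
          split-case : (∃ λ j → j < suc (c * n) × (∀ {x} → x ∈ X → x ∈ ball (suc j) l → x ∈ ball j l))
            ⊎ suc (c * n) ≤ length (filter (_∈L? ball (suc (c * n)) l) X) → length X ≤ length Y
          split-case (inj₂ big) = contradiction
            (≤-trans big (≤-trans (length-filter (_∈L? ball (suc (c * n)) l) X) small)) (<-irrefl refl)
          split-case (inj₁ (j , j< , sep)) = begin
              length X ≡⟨ length-split in? X ⟩
              length (filter in? X) + length (filter (¬? ∘ in?) X) ≤⟨ +-mono-≤ inner outer ⟩
              length (filter near? Y) + length (filter (¬? ∘ near?) Y) ≡⟨ ≡-sym (length-split near? Y) ⟩
              length Y ∎
            where
            open ≤-Reasoning
            in? : Decidable (_∈ ball j l)
            in? = _∈L? ball j l
            near? : Decidable (_∈ concatMap nb (filter in? X))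
            near? = _∈R? concatMap nb (filter in? X)
            inX? : Decidable (_∈ filter in? X)
            inX? = _∈L? filter in? X
            -- The inner part of `X` is rebuilt as a filter of `pool`, since only literal members of
            -- `sublists pool` were tested for deficiency.
            X* = filter inX? pool
            uX* : Unique X*
            uX* = filter⁺ inX? pool-unique
            toX* : ∀ {x} → x ∈ filter in? X → x ∈ X*
            toX* x∈ = let p , q = ∈-filter⁻ in? {xs = X} x∈ in
              ∈-filter⁺ inX? (∈-filter⁺ free? (∈-deduplicate⁺ _≟L_ (ball-mono j (suc (c * n)) l (<⇒≤ j<) q)) (All.lookup fX p)) x∈
            no-deficit : length X* ≤ length (remaining value X*)
            no-deficit = ≮⇒≥ λ def → proj₂ (proj₂ (proj₂ chosen)) (X* , filter∈sublists inX? pool , def)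
            to-near : ∀ {r} → r ∈ remaining value X* → r ∈ filter near? Y
            to-near r∈ with ∈-filter⁻ (remaining? value) {xs = deduplicate _≟R_ (concatMap nb X*)} r∈
            ... | r∈' , ¬u , ≢v with ∈-concatMap-find nb X* (∈-deduplicate⁻ _≟R_ (concatMap nb X*) r∈')
            ... | x , x∈ , r∈'' with proj₂ (∈-filter⁻ inX? {xs = pool} x∈)
            ... | x∈in with cov (proj₁ (∈-filter⁻ in? {xs = X} x∈in)) r∈''
            ... | inj₁ p = ∈-filter⁺ near? p (∈-concatMap nb x∈in r∈'')
            ... | inj₂ (inj₁ u) = contradiction u ¬u
            ... | inj₂ (inj₂ e) = contradiction e ≢v
            inner : length (filter in? X) ≤ length (filter near? Y)
            inner = begin
              length (filter in? X) ≤⟨ length-⊆ _ _ (filter⁺ in? uX) toX* ⟩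
              length X* ≤⟨ no-deficit ⟩
              length (remaining value X*) ≤⟨ length-⊆ _ _ (filter⁺ (remaining? value) (deduplicate-! _≟R_ (concatMap nb X*))) to-near ⟩
              length (filter near? Y) ∎
            outer : length (filter (¬? ∘ in?) X) ≤ length (filter (¬? ∘ near?) Y)
            outer = hall _ _ (filter⁺ (¬? ∘ in?) uX)
              (All.tabulate λ x∈ → weaken (All.lookup fX (proj₁ (∈-filter⁻ (¬? ∘ in?) {xs = X} x∈))))
              covers-outer
              where
              covers-outer : Covers match (filter (¬? ∘ in?) X) (filter (¬? ∘ near?) Y)
              covers-outer {x} {r} x∈ r∈ with ∈-filter⁻ (¬? ∘ in?) {xs = X} x∈
              ... | x∈X , x∉ with cov x∈X r∈
              ... | inj₂ (inj₁ u) = inj₂ u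
              -- A demand that sees `value` shares a slot with `l`, so it lies in `ball (suc j) l`,
              -- and the empty shell pushes it into `ball j l`.
              ... | inj₂ (inj₂ refl) = contradiction
                      (sep x∈X (ball-step j l (ball-centre j l) (proj₁ (proj₂ chosen)) (proj₁ (All.lookup fX x∈X)) r∈)) x∉
              ... | inj₁ r∈Y = inj₁ (∈-filter⁺ (¬? ∘ near?) r∈Y far)
                where
                far : ¬ r ∈ concatMap nb (filter in? X)
                far r∈' with ∈-concatMap-find nb (filter in? X) r∈'
                ... | x' , x'∈ , r∈'' = x∉ (sep x∈X (ball-step j l (proj₂ (∈-filter⁻ in? {xs = X} x'∈)) r∈'' (proj₁ (All.lookup fX x∈X)) r∈))

      open Choice

      extend : L → Maybe R
      extend l with Dom? l | code l ≟ n
      ... | yes dl | yes cl = just (value l dl cl)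
      ... | _ | no _ = match l
      ... | no _ | yes _ = nothing

      data View (l : L) : Maybe R → Set where
        fresh : (dl : Dom l) (cl : code l ≡ n) → View l (just (value l dl cl))
        old : code l ≢ n → View l (match l)
        outside : ¬ Dom l → View l nothing

      view : ∀ l → View l (extend l)
      view l with Dom? l | code l ≟ n
      ... | yes dl | yes cl = fresh dl cl
      ... | yes _ | no c≢ = old c≢
      ... | no _ | no c≢ = old c≢
      ... | no ¬d | yes _ = outside ¬d

      extend-old : ∀ {l} → code l ≢ n → extend l ≡ match l
      extend-old {l} c≢ with extend l | view l
      ... | _ | fresh dl cl = contradiction cl c≢
      ... | _ | old _ = refl
      ... | _ | outside ¬d with match l in eq
      ... | nothing = refl
      ... | just r = contradiction (proj₁ (sound eq)) ¬d

      Origin : L → R → Set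
      Origin l r = (match l ≡ just r × code l < n) ⊎ (Σ (Dom l) λ dl → Σ (code l ≡ n) λ cl → value l dl cl ≡ r)

      origin : ∀ {l r} → extend l ≡ just r → Origin l r
      origin {l} e with extend l | view l
      origin refl | _ | fresh dl cl = inj₂ (dl , cl , refl)
      origin e | _ | old _ = inj₁ (e , proj₁ (proj₂ (sound e)))
      origin () | _ | outside _

      unused-value : ∀ l dl cl → ¬ Used match (value l dl cl)
      unused-value l dl cl = proj₁ (proj₂ (proj₂ (chosen l dl cl)))

      next : Stage (suc n)
      next = record
        { match = extend
        ; sound = λ e → case origin e of λ
            { (inj₁ (e' , _)) → let d , lt , r∈ = sound e' in d , m≤n⇒m≤1+n lt , r∈
            ; (inj₂ (dl , cl , refl)) → dl , ≤-reflexive (cong suc cl) , proj₁ (proj₂ (chosen _ dl cl)) }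
        ; unique = λ e e' → unique' (origin e) (origin e')
        ; total = total'
        ; hall = hall'
        }
        where
        unique' : ∀ {l l' r} → Origin l r → Origin l' r → l ≡ l'
        unique' (inj₁ (e , _)) (inj₁ (e' , _)) = unique e e'
        unique' (inj₁ (e , _)) (inj₂ (dl , cl , refl)) = contradiction (_ , e) (unused-value _ dl cl)
        unique' (inj₂ (dl , cl , refl)) (inj₁ (e , _)) = contradiction (_ , e) (unused-value _ dl cl)
        unique' (inj₂ (_ , cl , _)) (inj₂ (_ , cl' , _)) = code-inj (≡-trans cl (≡-sym cl'))
        total' : ∀ {l} → Dom l → code l < suc n → ∃ λ r → extend l ≡ just r
        total' {l} d lt with extend l | view l
        ... | _ | fresh _ _ = _ , refl
        ... | _ | old c≢ = total d (≤∧≢⇒< (≤-pred lt) c≢)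
        ... | _ | outside ¬d = contradiction d ¬d
        Fresh : Set
        Fresh = ∃ λ l → Σ (Dom l) λ dl → Σ (code l ≡ n) λ cl → extend l ≡ just (value l dl cl)
        hall' : ∀ X Y → Unique X → All (Free (suc n)) X → Covers extend X Y → length X ≤ length Y
        -- Whether a demand of code `n` exists cannot be decided, but the goal is a decidable
        -- inequality, so a double-negated case distinction suffices.
        hall' X Y uX fX cov = decidable-stable (length X ≤? length Y) λ ¬le → ¬¬-excluded-middle {A = Fresh} λ
          { (yes fresh-l) → ¬le (with-fresh fresh-l)
          ; (no none) → ¬le (without-fresh none) }
          where
          with-fresh : Fresh → length X ≤ length Y
          with-fresh (l , dl , cl , el) = safe l dl cl X Y uX fX cov'
            where
            cov' : ∀ {l' r'} → l' ∈ X → r' ∈ nb l' → r' ∈ Y ⊎ Used match r' ⊎ r' ≡ value l dl cl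
            cov' l∈ r∈ with cov l∈ r∈
            ... | inj₁ p = inj₁ p
            ... | inj₂ (l' , e) with origin e
            ... | inj₁ (e' , _) = inj₂ (inj₁ (l' , e'))
            ... | inj₂ (_ , cl' , _) = inj₂ (inj₂ (just-injective
                    (≡-trans (≡-sym e) (≡-trans (cong extend (code-inj (≡-trans cl' (≡-sym cl)))) el))))
          without-fresh : ¬ Fresh → length X ≤ length Y
          without-fresh none = hall X Y uX (All.map (λ { (d , le) → d , ≤-trans (n≤1+n n) le }) fX) cov'
            where
            cov' : Covers match X Y
            cov' l∈ r∈ with cov l∈ r∈
            ... | inj₁ p = inj₁ p
            ... | inj₂ (l' , e) with origin e
            ... | inj₁ (e' , _) = inj₂ (l' , e')
            ... | inj₂ (dl , cl , refl) = contradiction (l' , dl , cl , e) none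

    stage : ∀ n → Stage n
    stage zero = record
      { match = λ _ → nothing
      ; sound = λ ()
      ; unique = λ ()
      ; total = λ _ ()
      ; hall = λ X Y uX fX cov → *-cancelˡ-≤ (suc c) (≤-trans
          (expand X Y uX (All.map proj₁ fX) λ l∈ r∈ → case cov l∈ r∈ of λ { (inj₁ p) → p ; (inj₂ ()) })
          (*-monoˡ-≤ (length Y) (n≤1+n c)))
      }
    stage (suc n) = Extend.next (stage n)

    -- The limit of the stages: the value at `l` is settled at stage `suc (code l)` and never
    -- revised, so it can be read off there.
    matched : L → Maybe R
    matched l = Stage.match (stage (suc (code l))) l

    stable : ∀ {l} n → code l < n → Stage.match (stage n) l ≡ matched l
    stable {l} (suc n) lt with m≤n⇒m<n∨m≡n (≤-pred lt)
    ... | inj₂ refl = refl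
    ... | inj₁ lt' = ≡-trans (Extend.extend-old (stage n) (<⇒≢ lt')) (stable n lt')

    matched-sound : ∀ {l r} → matched l ≡ just r → r ∈ nb l
    matched-sound {l} e = proj₂ (proj₂ (Stage.sound (stage (suc (code l))) e))

    matched-total : ∀ {l} → Dom l → ∃ λ r → matched l ≡ just r
    matched-total {l} d = Stage.total (stage (suc (code l))) d ≤-refl

    matched-injective : ∀ {l l' r} → matched l ≡ just r → matched l' ≡ just r → l ≡ l'
    matched-injective {l} {l'} e e' = Stage.unique (stage n)
        (≡-trans (stable n (s≤s (m≤m+n (code l) (code l')))) e)
        (≡-trans (stable n (s≤s (m≤n+m (code l') (code l)))) e')
      where n = suc (code l + code l')

  -- Ranking a graph with disjoint families of kids

  least : {P : ℕ → Set} → Decidable P → ∀ n → P n → ∃ λ m → P m × m ≤ n × (∀ k → k < m → ¬ P k)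
  least P? zero p = zero , p , z≤n , λ _ ()
  least {P} P? (suc n) p with P? zero
  ... | yes p₀ = zero , p₀ , z≤n , λ _ ()
  ... | no ¬p₀ with least {λ m → P (suc m)} (λ m → P? (suc m)) n p
  ... | m , pm , m≤n , min = suc m , pm , s≤s m≤n , λ { zero _ → ¬p₀ ; (suc k) (s≤s lt) → min k lt }

  n≤2^n : ∀ n → n ≤ 2 ^ n
  n≤2^n zero = z≤n
  n≤2^n (suc n) = begin
    1 + n ≤⟨ +-mono-≤ (m^n>0 2 n) (n≤2^n n) ⟩
    2 ^ n + 2 ^ n ≡⟨ cong (2 ^ n +_) (≡-sym (+-identityʳ (2 ^ n))) ⟩
    2 ^ suc n ∎
    where open ≤-Reasoning

  -- Markov's inequality in counting form.
  length-filter-weigh : {A : Set} {P : A → Set} (P? : Decidable P) {m : ℕ} (f : A → ℕ) →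
    (∀ {x} → P x → m ≤ f x) → ∀ xs → length (filter P? xs) * m ≤ sum (map f xs)
  length-filter-weigh P? f h [] = z≤n
  length-filter-weigh P? f h (x ∷ xs) with P? x
  ... | yes p = +-mono-≤ (h p) (length-filter-weigh P? f h xs)
  ... | no _ = ≤-trans (length-filter-weigh P? f h xs) (m≤n+m _ (f x))

  module Ranking
    {V : Set} (code : V → ℕ) (code-inj : ∀ {u v} → code u ≡ code v → u ≡ v)
    (kids : V → List V) (kids-unique : ∀ w → Unique (kids w))
    (kids-disjoint : ∀ {x w w'} → x ∈ kids w → x ∈ kids w' → w ≡ w')
    where

    -- Kids may form cycles, so a vertex can recur at several depths. The levels are therefore kept
    -- apart: only within one level is a repetition excluded.
    descendants : ℕ → V → List V
    descendants zero w = [ w ]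
    descendants (suc i) w = concatMap (descendants i) (kids w)

    descendants-disjoint : ∀ i {x x' y} → y ∈ descendants i x → y ∈ descendants i x' → x ≡ x'
    descendants-disjoint zero (here refl) (here refl) = refl
    descendants-disjoint (suc i) {x} {x'} p q
      with ∈-concatMap-find (descendants i) (kids x) p | ∈-concatMap-find (descendants i) (kids x') q
    ... | z , z∈ , p' | z' , z'∈ , q' with descendants-disjoint i p' q'
    ... | refl = kids-disjoint z∈ z'∈

    descendants-unique : ∀ i w → Unique (descendants i w)
    descendants-unique zero w = [] ∷ []
    descendants-unique (suc i) w = concatMap-unique (descendants i) (kids w) (kids-unique w)
      (λ {x} _ → descendants-unique i x) (descendants-disjoint i)

    before? : ∀ t → Decidable (λ y → code y < t)
    before? t y = code y <? t

    count : ℕ → ℕ → V → ℕ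
    count t i w = length (filter (before? t) (descendants i w))

    count-step : ∀ t i w → sum (map (count t i) (kids w)) ≡ count t (suc i) w
    count-step t i w = go (kids w)
      where
      go : ∀ xs → sum (map (count t i) xs) ≡ length (filter (before? t) (concatMap (descendants i) xs))
      go [] = refl
      go (x ∷ xs) = ≡-trans (cong (count t i x +_) (go xs)) (≡-trans (≡-sym (length-++ (filter (before? t) (descendants i x))))
        (cong length (≡-sym (filter-++ (before? t) (descendants i x) (concatMap (descendants i) xs)))))

    count-bound : ∀ t i w → count t i w ≤ t
    count-bound t i w = length-bounded (λ y k → code y ≡ k) (λ e e' → code-inj (≡-trans e (≡-sym e'))) t _
      (filter⁺ (before? t) (descendants-unique i w))
      λ {y} y∈ → code y , proj₂ (∈-filter⁻ (before? t) {xs = descendants i w} y∈) , refl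

    count-jump : ∀ t i w → count (suc t) i w ≤ suc (count t i w)
    count-jump t i w = length-filter-gap (before? t) (before? (suc t)) m≤n⇒m≤1+n
      (λ p ¬q p' ¬q' → code-inj (≡-trans (newest p ¬q) (≡-sym (newest p' ¬q')))) (descendants i w) (descendants-unique i w)
      where
      newest : ∀ {c} → c < suc t → ¬ c < t → c ≡ t
      newest p ¬q = ≤-antisym (≤-pred p) (≮⇒≥ ¬q)

    count-mono : ∀ t i w → count t i w ≤ count (suc t) i w
    count-mono t i w = length-filter-mono (before? t) (before? (suc t)) m≤n⇒m≤1+n (descendants i w)

    -- Σ_{i ≤ m} 2^(m-i) · count t i w
    potential : ℕ → ℕ → V → ℕ
    potential t zero w = count t zero w
    potential t (suc m) w = 2 * potential t m w + count t (suc m) w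

    -- Level `i` below the kids is level `suc i` below `w`, with the same factor 2^(m-i); the right
    -- side has in addition the term of `w` itself.
    potential-kids : ∀ t m w → sum (map (potential t m) (kids w)) ≤ potential t (suc m) w
    potential-kids t zero w = ≤-trans (≤-reflexive (count-step t zero w)) (m≤n+m _ _)
    potential-kids t (suc m) w = begin
      sum (map (potential t (suc m)) (kids w)) ≡⟨ expand (kids w) ⟩
      2 * sum (map (potential t m) (kids w)) + sum (map (count t (suc m)) (kids w))
        ≤⟨ +-mono-≤ (*-monoʳ-≤ 2 (potential-kids t m w)) (≤-reflexive (count-step t (suc m) w)) ⟩
      2 * potential t (suc m) w + count t (suc (suc m)) w ∎
      where
      open ≤-Reasoning
      arrange : ∀ a b c d → (2 * a + b) + (2 * c + d) ≡ 2 * (a + c) + (b + d)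
      arrange = solve-∀
      expand : ∀ xs → sum (map (potential t (suc m)) xs) ≡ 2 * sum (map (potential t m) xs) + sum (map (count t (suc m)) xs)
      expand [] = refl
      expand (x ∷ xs) = ≡-trans (cong (potential t (suc m) x +_) (expand xs))
        (arrange (potential t m x) (count t (suc m) x) (sum (map (potential t m) xs)) (sum (map (count t (suc m)) xs)))

    -- Only the vertex of code `t` is new, so each level gains at most one, and the factors 2^(m-i)
    -- add up to 2^(m+1) - 1.
    potential-jump : ∀ t m w → suc (potential (suc t) m w) ≤ potential t m w + 2 ^ suc m
    potential-jump t zero w = ≤-trans (s≤s (count-jump t zero w)) (≤-reflexive (+-comm 2 (count t zero w)))
    potential-jump t (suc m) w = begin
      suc (2 * p' + c') ≤⟨ s≤s (+-monoʳ-≤ (2 * p') (count-jump t (suc m) w)) ⟩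
      suc (2 * p' + suc c) ≡⟨ arrange₁ p' c ⟩
      2 * suc p' + c ≤⟨ +-monoˡ-≤ c (*-monoʳ-≤ 2 (potential-jump t m w)) ⟩
      2 * (p + 2 ^ suc m) + c ≡⟨ arrange₂ p (2 ^ suc m) c ⟩
      2 * p + c + 2 * 2 ^ suc m ∎
      where
      open ≤-Reasoning
      p' = potential (suc t) m w
      p = potential t m w
      c' = count (suc t) (suc m) w
      c = count t (suc m) w
      arrange₁ : ∀ a b → suc (2 * a + suc b) ≡ 2 * suc a + b
      arrange₁ = solve-∀
      arrange₂ : ∀ a b d → 2 * (a + b) + d ≡ 2 * a + d + 2 * b
      arrange₂ = solve-∀

    potential-mono : ∀ t m w → potential t m w ≤ potential (suc t) m w
    potential-mono t zero w = count-mono t zero w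
    potential-mono t (suc m) w = +-mono-≤ (*-monoʳ-≤ 2 (potential-mono t m w)) (count-mono t (suc m) w)

    -- The inequality "weight at least 1", scaled by 2^t. The depth is cut at `t` as well, which
    -- keeps the sum finite and the test decidable.
    Ripe : V → ℕ → Set
    Ripe w t = 2 ^ t ≤ potential t t w

    ripe? : ∀ w → Decidable (Ripe w)
    ripe? w t = 2 ^ t ≤? potential t t w

    -- One more level doubles the old terms along with the threshold, and a later time only adds
    -- descendants.
    ripe-step : ∀ w t → Ripe w t → Ripe w (suc t)
    ripe-step w t r = begin
      2 * 2 ^ t ≤⟨ *-monoʳ-≤ 2 r ⟩
      2 * potential t t w ≤⟨ m≤m+n _ _ ⟩
      potential t (suc t) w ≤⟨ potential-mono t (suc t) w ⟩
      potential (suc t) (suc t) w ∎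
      where open ≤-Reasoning

    ripe-mono : ∀ w {s t} → s ≤ t → Ripe w s → Ripe w t
    ripe-mono w {zero} {zero} z≤n r = r
    ripe-mono w {s} {suc t} le r with m≤n⇒m<n∨m≡n le
    ... | inj₂ refl = r
    ... | inj₁ lt = ripe-step w t (ripe-mono w (≤-pred lt) r)

    potential-large : ∀ t w m → code w < t → 2 ^ m ≤ potential t m w
    potential-large t w zero lt = filter-some (before? t) (here lt)
    potential-large t w (suc m) lt = ≤-trans (*-monoʳ-≤ 2 (potential-large t w m lt)) (m≤m+n _ _)

    -- As soon as `code w < t`, the vertex `w` alone provides weight 1 at depth 0.
    ripening : ∀ w → ∃ λ t → Ripe w t × t ≤ suc (code w) × (∀ k → k < t → ¬ Ripe w k)
    ripening w = least (ripe? w) (suc (code w)) (potential-large (suc (code w)) w (suc (code w)) ≤-refl)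

    rank : V → ℕ
    rank w = proj₁ (ripening w)

    early? : ∀ w → Decidable (λ x → rank x ≤ rank w)
    early? w x = rank x ≤? rank w

    -- In units of `2 ^ suc t`: each early kid weighs at least 1, and all kids together weigh at
    -- most twice as much as `w` plus one further level. As `w` is unripe at `t`, its old weight
    -- contributes less than 2, the last time step at most 4, and the level counts, linear in `t`,
    -- at most 3. So there are fewer than 9 early kids.
    few-ripe-kids : ∀ w s → Ripe w s → (∀ k → k < s → ¬ Ripe w k) →
      length (filter (λ x → rank x ≤? s) (kids w)) ≤ 8
    -- No code is below 0, so nothing is ripe at time 0.
    few-ripe-kids w zero r _ = contradiction (count-bound 0 0 w) (<⇒≱ r)
    few-ripe-kids w (suc t) _ unripe = ≤-pred (*-cancelʳ-< (2 ^ suc t) _ 9 (begin-strict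
        length (filter (λ x → rank x ≤? suc t) (kids w)) * 2 ^ suc t 
          ≤⟨ length-filter-weigh (λ x → rank x ≤? suc t) (potential (suc t) (suc t)) early-ripe (kids w) ⟩
        sum (map (potential (suc t) (suc t)) (kids w)) ≤⟨ potential-kids (suc t) (suc t) w ⟩
        2 * potential (suc t) (suc t) w + count (suc t) (suc (suc t)) w
          ≤⟨ +-mono-≤ (*-monoʳ-≤ 2 before-jump) (count-bound (suc t) (suc (suc t)) w) ⟩
        2 * (2 * potential t t w + t + 2 * 2 ^ suc t) + suc t <⟨ s≤s (+-monoˡ-≤ (suc t) (*-monoʳ-≤ 2 (+-monoˡ-≤ (2 * 2 ^ suc t) (+-monoˡ-≤ t (≤-refl {2 * potential t t w}))))) ⟩
        suc (2 * (2 * potential t t w + t + 2 * 2 ^ suc t) + suc t) ≡⟨ arrange₁ (potential t t w) t (2 ^ suc t) ⟩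
        4 * potential t t w + (3 * t + 2) + 4 * 2 ^ suc t ≤⟨ +-monoˡ-≤ (4 * 2 ^ suc t) bound ⟩
        5 * 2 ^ suc t + 4 * 2 ^ suc t ≡⟨ ≡-sym (*-distribʳ-+ (2 ^ suc t) 5 4) ⟩
        9 * 2 ^ suc t ∎))
      where
      open ≤-Reasoning
      arrange₁ : ∀ p t q → suc (2 * (2 * p + t + 2 * q) + suc t) ≡ 4 * p + (3 * t + 2) + 4 * q
      arrange₁ = solve-∀
      arrange₂ : ∀ p t → 4 * p + (3 * t + 2) + 2 ≡ 4 * suc p + 3 * t
      arrange₂ = solve-∀
      arrange₃ : ∀ q → 4 * q + 3 * q + 3 * q ≡ 5 * (2 * q)
      arrange₃ = solve-∀
      bound : 4 * potential t t w + (3 * t + 2) ≤ 5 * 2 ^ suc t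
      bound = begin
        4 * potential t t w + (3 * t + 2) ≤⟨ m≤m+n _ 2 ⟩
        4 * potential t t w + (3 * t + 2) + 2 ≡⟨ arrange₂ (potential t t w) t ⟩
        4 * suc (potential t t w) + 3 * t ≤⟨ +-mono-≤ (*-monoʳ-≤ 4 (≰⇒> (unripe t ≤-refl))) (*-monoʳ-≤ 3 (n≤2^n t)) ⟩
        4 * 2 ^ t + 3 * 2 ^ t ≤⟨ m≤m+n _ _ ⟩
        4 * 2 ^ t + 3 * 2 ^ t + 3 * 2 ^ t ≡⟨ arrange₃ (2 ^ t) ⟩
        5 * 2 ^ suc t ∎
      before-jump : potential (suc t) (suc t) w ≤ 2 * potential t t w + t + 2 * 2 ^ suc t
      before-jump = begin
        potential (suc t) (suc t) w ≤⟨ n≤1+n _ ⟩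
        suc (potential (suc t) (suc t) w) ≤⟨ potential-jump t (suc t) w ⟩
        2 * potential t t w + count t (suc t) w + 2 ^ suc (suc t) ≤⟨ +-monoˡ-≤ _ (+-monoʳ-≤ (2 * potential t t w) (count-bound t (suc t) w)) ⟩
        2 * potential t t w + t + 2 * 2 ^ suc t ∎
      early-ripe : ∀ {x} → rank x ≤ suc t → Ripe x (suc t)
      early-ripe {x} le = ripe-mono x le (proj₁ (proj₂ (ripening x)))

    few-early-kids : ∀ w → length (filter (early? w) (kids w)) ≤ 8
    few-early-kids w = few-ripe-kids w (rank w) (proj₁ (proj₂ (ripening w))) (proj₂ (proj₂ (proj₂ (ripening w))))

  -- Rooted forests

  module RootedForest
    (G : Graph) (Δ : ℕ) (Par : V G → V G → Set)
    (par-functional : ∀ {x w w'} → Par x w → Par x w' → w ≡ w')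
    (par-adj : ∀ {x w} → Par x w → Adj G w x)
    (rank : V G → ℕ) (par-rank : ∀ {x w} → Par x w → rank w < rank x)
    (parent? : ∀ x → (∃ λ w → Par x w) ⊎ (∀ w → ¬ Par x w))
    (children : ∀ w → Σ (List (V G)) λ ns → length ns ≡ Δ × Unique ns × (∀ x → Par x w ⇔ (x ∈ ns)))
    (par-induced : ∀ {x y p q} → Par x p → Par y q → Adj G x y → Par x y ⊎ Par y x)
    (root-induced : ∀ {x p r} → Par x p → Star Par x r → (∀ w → ¬ Par r w) → Adj G x r → Par x r)
    where

    Root : V G → Set
    Root r = ∀ w → ¬ Par r w

    Edge : V G → V G → Set
    Edge u v = Par u v ⊎ Par v u

    forest : SpanningSubgraph G
    forest = record
      { E = Edge
      ; sub = λ { (inj₁ p) → Graph.sym G (par-adj p) ; (inj₂ p) → par-adj p }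
      ; E-sym = ⊎-swap }

    data Depth : V G → V G → ℕ → Set where
      root : ∀ {r} → Root r → Depth r r zero
      child : ∀ {x w r k} → Par x w → Depth w r k → Depth x r (suc k)

    depth-exists : ∀ x → ∃ λ r → ∃ λ k → Depth x r k
    depth-exists x = go x (<-wellFounded (rank x))
      where
      go : ∀ x → Acc _<_ (rank x) → ∃ λ r → ∃ λ k → Depth x r k
      go x (acc rs) with parent? x
      ... | inj₂ none = x , zero , root none
      ... | inj₁ (w , p) with go w (rs (par-rank p))
      ... | r , k , d = r , suc k , child p d

    depth-functional : ∀ {x r r' k k'} → Depth x r k → Depth x r' k' → r ≡ r' × k ≡ k'
    depth-functional (root _) (root _) = refl , refl
    depth-functional (root none) (child p _) = contradiction p (none _)
    depth-functional (child p _) (root none) = contradiction p (none _)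
    depth-functional (child p d) (child p' d') with par-functional p p'
    ... | refl with depth-functional d d'
    ... | refl , refl = refl , refl

    depth-root : ∀ {x r k} → Depth x r k → Root r
    depth-root (root none) = none
    depth-root (child _ d) = depth-root d

    depth-chain : ∀ {x r k} → Depth x r k → Star Par x r
    depth-chain (root _) = ε
    depth-chain (child p d) = p ◅ depth-chain d

    depth-conn : ∀ {x r k} → Depth x r k → Conn Edge x r
    depth-conn (root _) = ε
    depth-conn (child p d) = inj₁ p ◅ depth-conn d

    -- The upper bound on the new depth is what `walk-depth` iterates: a walk of length `n` from the
    -- root reaches depth at most `n`, hence depths are distances.
    edge-root : ∀ {u v r k} → Edge u v → Depth u r k → ∃ λ k' → Depth v r k' × k' ≤ suc k
    edge-root (inj₂ p) d = _ , child p d , ≤-refl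
    edge-root (inj₁ p) (root none) = contradiction p (none _)
    edge-root (inj₁ p) (child p' d) with par-functional p p'
    ... | refl = _ , d , m≤n⇒m≤1+n (n≤1+n _)

    conn-root : ∀ {u v r k} → Conn Edge u v → Depth u r k → ∃ λ k' → Depth v r k'
    conn-root ε d = _ , d
    conn-root (e ◅ es) d = conn-root es (proj₁ (proj₂ (edge-root e d)))

    walk-snoc : ∀ {u v w n} → Walk Edge u v n → Edge v w → Walk Edge u w (suc n)
    walk-snoc {n = zero} refl e = _ , e , refl
    walk-snoc {n = suc n} (x , e' , ws) e = x , e' , walk-snoc ws e

    depth-walk : ∀ {x r k} → Depth x r k → Walk Edge r x k
    depth-walk (root _) = refl
    depth-walk (child p d) = walk-snoc (depth-walk d) (inj₂ p)

    walk-depth : ∀ {u v r k} n → Walk Edge u v n → Depth u r k → ∃ λ k' → Depth v r k' × k' ≤ n + k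
    walk-depth zero refl d = _ , d , ≤-refl
    walk-depth {k = k} (suc n) (x , e , ws) d with edge-root e d
    ... | k₁ , d₁ , le₁ with walk-depth n ws d₁
    ... | k₂ , d₂ , le₂ = k₂ , d₂ , ≤-trans le₂ (≤-trans (+-monoʳ-≤ n le₁) (≤-reflexive (+-suc n k)))

    depth-dist : ∀ {x r k} → Depth x r k → Dist Edge r x k
    depth-dist {x} {r} {k} d = depth-walk d , shortest
      where
      shortest : ∀ m → Walk Edge r x m → k ≤ m
      shortest m ws with walk-depth m ws (root (depth-root d))
      ... | k' , d' , le with depth-functional d' d
      ... | _ , refl = subst (k ≤_) (+-identityʳ m) le

    dist-depth : ∀ {x r n k} → Dist Edge r x n → Depth x r k → n ≡ k
    dist-depth (ws , min) d = ≤-antisym (min _ (proj₁ (depth-dist d))) (proj₂ (depth-dist d) _ ws)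

    -- `Child` is phrased by distance from the root. Distances are depths, so the parent of `u`,
    -- being one level closer, cannot qualify.
    child-par : ∀ {r u x k} → Depth u r k → Child Edge r u x → Par x u
    child-par d (inj₂ p , _) = p
    child-par (root none) (inj₁ p , _) = contradiction p (none _)
    child-par (child p' d') (inj₁ p , n , du , dx) with par-functional p p'
    ... | refl with dist-depth du (child p' d') | dist-depth dx d'
    ... | refl | ()

    child⇔par : ∀ {r u k} → Depth u r k → ∀ x → Child Edge r u x ⇔ Par x u
    child⇔par {k = k} d x = mk⇔ (child-par d) λ p → inj₂ p , k , depth-dist d , depth-dist (child p d)

    tree-component : ∀ v → DeltaAryTreeComponent Edge Δ v
    tree-component v with depth-exists v
    ... | r , k , d = r , depth-conn d , degree
      where
      degree : ∀ u → Conn Edge v u → HasDegree (Child Edge r) u Δ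
      degree u c with conn-root c d | children u
      ... | k' , d' | ns , len , uniq , iff = ns , len , uniq , λ x →
        mk⇔ (Equivalence.to (iff x) ∘ Equivalence.to (child⇔par d' x))
            (Equivalence.from (child⇔par d' x) ∘ Equivalence.from (iff x))

    next : List (V G) → V G → V G
    next [] b = b
    next (x ∷ xs) b = x

    penultimate : V G → List (V G) → V G
    penultimate a [] = a
    penultimate a (x ∷ xs) = penultimate x xs

    penultimate-∈ : ∀ a xs → penultimate a xs ∈ a ∷ xs
    penultimate-∈ a [] = here refl
    penultimate-∈ a (x ∷ xs) = there (penultimate-∈ x xs)

    NonBacktracking : V G → List (V G) → V G → Set
    NonBacktracking a [] b = ⊤
    NonBacktracking a (x ∷ xs) b = a ≢ next xs b × NonBacktracking x xs b

    -- A walk that has just come down from the parent `p` of `a` and does not turn back must go down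
    -- again, because `p` is the only way up.
    forced-descent : ∀ {p a} xs {b} → Par a p → p ≢ next xs b → NonBacktracking a xs b →
      Linked Edge (a ∷ xs ++ [ b ]) → rank a < rank b × Par b (penultimate a xs)
    forced-descent [] ap p≢ _ (inj₁ ab ∷ _) = contradiction (par-functional ap ab) p≢
    forced-descent [] ap p≢ _ (inj₂ ba ∷ _) = par-rank ba , ba
    forced-descent (x ∷ xs) ap p≢ _ (inj₁ ax ∷ _) = contradiction (par-functional ap ax) p≢
    forced-descent (x ∷ xs) ap p≢ (a≢ , nb) (inj₂ xa ∷ l) with forced-descent xs xa a≢ nb l
    ... | lt , bp = <-trans (par-rank xa) lt , bp

    -- Once a non-backtracking walk takes a step down it goes down for good, so either it rises
    -- throughout or its last step is a descent.
    ascent-or-final-descent : ∀ {a} xs {b} → NonBacktracking a xs b → Linked Edge (a ∷ xs ++ [ b ]) →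
      rank b < rank a ⊎ Par b (penultimate a xs)
    ascent-or-final-descent [] _ (inj₁ ab ∷ _) = inj₁ (par-rank ab)
    ascent-or-final-descent [] _ (inj₂ ba ∷ _) = inj₂ ba
    ascent-or-final-descent (x ∷ xs) (a≢ , nb) (inj₂ xa ∷ l) = inj₂ (proj₂ (forced-descent xs xa a≢ nb l))
    ascent-or-final-descent (x ∷ xs) (a≢ , nb) (inj₁ ax ∷ l) with ascent-or-final-descent xs nb l
    ... | inj₁ lt = inj₁ (<-trans lt (par-rank ax))
    ... | inj₂ bp = inj₂ bp

    unique-nonbacktracking : ∀ x xs {b} → Unique (x ∷ xs) → All (b ≢_) (x ∷ xs) → NonBacktracking x xs b
    unique-nonbacktracking x [] _ _ = _
    unique-nonbacktracking x (y ∷ []) _ (b≢ ∷ _) = b≢ ∘ ≡-sym , _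
    unique-nonbacktracking x (y ∷ z ∷ xs) ((_ ∷ x≢ ∷ _) ∷ u) (_ ∷ bs) = x≢ , unique-nonbacktracking y (z ∷ xs) u bs

    -- A cycle that starts downwards descends all the way and cannot return to its own rank. One
    -- that starts upwards must end with a descent into `a`; that step comes from the only parent of
    -- `a`, which is `x`, yet `x` occurs just once.
    acyclic : ¬ Cycle Edge
    acyclic (cycle a (x ∷ []) (s≤s ()) _ _)
    acyclic (cycle a (x ∷ y ∷ xs) _ (a∉@(_ ∷ a≢y ∷ _) ∷ u) (inj₂ xa ∷ l)) =
      <-asym (par-rank xa) (proj₁ (forced-descent (y ∷ xs) xa a≢y (unique-nonbacktracking x (y ∷ xs) u a∉) l))
    acyclic (cycle a (x ∷ y ∷ xs) _ (a∉ ∷ u@(x∉ ∷ _)) (inj₁ ax ∷ l))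
      with ascent-or-final-descent (y ∷ xs) (unique-nonbacktracking x (y ∷ xs) u a∉) l
    ... | inj₁ lt = <-asym lt (par-rank ax)
    ... | inj₂ az = All.lookup x∉ (penultimate-∈ y xs) (par-functional ax az)

    -- Connected vertices have a common root, so two non-roots fall under `par-induced` and a root
    -- with a non-root under `root-induced`.
    componentwise-induced : ComponentwiseInduced G forest
    componentwise-induced u v c uv with depth-exists u
    ... | r , _ , du with conn-root c du
    ... | _ , dv = join du dv
      where
      join : ∀ {r k k'} → Depth u r k → Depth v r k' → Edge u v
      join (root _) (root _) = contradiction uv (irrefl G)
      join (root none) d@(child p _) = inj₂ (root-induced p (depth-chain d) none (Graph.sym G uv))
      join d@(child p _) (root none) = inj₁ (root-induced p (depth-chain d) none uv)
      join (child p _) (child q _) = par-induced p q uv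

    delete-roots : DeleteOnePerComponentInducedForest G forest
    delete-roots = Root , reaches-root , one-root , off-roots , λ c → contradiction c acyclic
      where
      reaches-root : ∀ v → ∃ λ s → Root s × Conn Edge v s
      reaches-root v with depth-exists v
      ... | r , _ , d = r , depth-root d , depth-conn d
      one-root : ∀ s s' → Root s → Root s' → Conn Edge s s' → s ≡ s'
      one-root s s' rs rs' c = proj₁ (depth-functional (proj₂ (conn-root c (root rs))) (root rs'))
      off-roots : ∀ u v → ¬ Root u → ¬ Root v → Adj G u v → Edge u v
      off-roots u v ¬ru ¬rv uv with parent? u | parent? v
      ... | inj₂ ru | _ = contradiction ru ¬ru
      ... | inj₁ _ | inj₂ rv = contradiction rv ¬rv
      ... | inj₁ (_ , p) | inj₁ (_ , q) = par-induced p q uv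

    delta-ary : DeltaAryPseudoforest Edge Δ
    delta-ary = (λ c → contradiction c acyclic)
      , λ v → (λ _ → tree-component v) , λ { (c , _) → contradiction c acyclic }

  -- Choosing the children

  ∈-take : {A : Set} → ∀ n (xs : List A) {x} → x ∈ take n xs → x ∈ xs
  ∈-take (suc n) (x ∷ xs) (here e) = here e
  ∈-take (suc n) (x ∷ xs) (there p) = there (∈-take n xs p)

  module Selection
    (G : Graph) (Δ : ℕ) (_≟V_ : DecidableEquality (V G)) (adj? : ∀ u v → Dec (Adj G u v))
    (nbrs : V G → List (V G)) (nbrs-complete : ∀ {v w} → Adj G v w → w ∈ nbrs v)
    (kids : V G → List (V G)) (kids-unique : ∀ w → Unique (kids w))
    (kids-adj : ∀ {x w} → x ∈ kids w → Adj G w x)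
    (kids-disjoint : ∀ {x w w'} → x ∈ kids w → x ∈ kids w' → w ≡ w')
    (kids-induced : ∀ {x y w z} → x ∈ kids w → y ∈ kids z → Adj G x y → y ≡ w ⊎ x ≡ z)
    (kids-sparse : ∀ w r → r ≢ w → length (filter (λ x → adj? x r) (kids w)) ≤ 2)
    (kids-many : ∀ w → Δ + 10 ≤ length (kids w))
    (rank : V G → ℕ)
    (few-early-kids : ∀ w → length (filter (λ x → rank x ≤? rank w) (kids w)) ≤ 8)
    where

    open DecMembership _≟V_ using (_∈?_)

    -- `r` stands for the root of `w`. An adopted kid adjacent to the root would spoil inducedness
    -- there, except when `w` is itself the root and the adjacency becomes a forest edge.
    Good : V G → V G → V G → Set
    Good r w x = rank w < rank x × (r ≡ w ⊎ ¬ Adj G x r)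

    good? : ∀ r w → Decidable (Good r w)
    good? r w x = (rank w <? rank x) ×-dec ((r ≟V w) ⊎-dec ¬? (adj? x r))

    -- The 10 spare kids pay for the 8 of small rank and the 2 adjacent to `r`.
    many-good : ∀ r w → Δ ≤ length (filter (good? r w) (kids w))
    many-good r w = +-cancelʳ-≤ 10 Δ _ (begin
      Δ + 10 ≤⟨ kids-many w ⟩
      length (kids w) ≤⟨ length-cover (good? r w) (λ x → rank x ≤? rank w) hit? cover (kids w) ⟩
      length (filter (good? r w) (kids w)) + (length (filter (λ x → rank x ≤? rank w) (kids w)) + length (filter hit? (kids w)))
        ≤⟨ +-monoʳ-≤ (length (filter (good? r w) (kids w))) (+-mono-≤ (few-early-kids w) few-hits) ⟩
      length (filter (good? r w) (kids w)) + 10 ∎)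
      where
      open ≤-Reasoning
      hit? : Decidable (λ x → r ≢ w × Adj G x r)
      hit? x = ¬? (r ≟V w) ×-dec adj? x r
      cover : ∀ x → Good r w x ⊎ rank x ≤ rank w ⊎ (r ≢ w × Adj G x r)
      cover x with rank w <? rank x | r ≟V w | adj? x r
      ... | no ≮ | _ | _ = inj₂ (inj₁ (≮⇒≥ ≮))
      ... | yes lt | yes e | _ = inj₁ (lt , inj₁ e)
      ... | yes lt | no _ | no ¬a = inj₁ (lt , inj₂ ¬a)
      ... | yes lt | no ≢ | yes a = inj₂ (inj₂ (≢ , a))
      hits-bounded : Dec (r ≡ w) → length (filter hit? (kids w)) ≤ 2
      hits-bounded (no ≢) = ≤-trans (length-filter-mono hit? (λ x → adj? x r) proj₂ (kids w)) (kids-sparse w r ≢)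
      hits-bounded (yes e) = ≤-trans (≤-reflexive (cong length (filter-none hit? (All.universal (λ x h → proj₁ h e) (kids w))))) z≤n
      few-hits : length (filter hit? (kids w)) ≤ 2
      few-hits = hits-bounded (r ≟V w)

    select : V G → V G → List (V G)
    select r w = take Δ (filter (good? r w) (kids w))

    select-sound : ∀ {r w x} → x ∈ select r w → x ∈ kids w × Good r w x
    select-sound {r} {w} x∈ = ∈-filter⁻ (good? r w) (∈-take Δ _ x∈)

    -- The root of a vertex, known as soon as n exceeds its rank.
    rootAt : ℕ → V G → V G
    rootAt zero w = w
    rootAt (suc n) w with rank w ≟ n | any? (λ p → w ∈? select (rootAt n p) p) (nbrs w)
    ... | no _ | _ = rootAt n w
    ... | yes _ | yes a = rootAt n (proj₁ (find a))
    ... | yes _ | no _ = w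

    root : V G → V G
    root w = rootAt (suc (rank w)) w

    rootAt-old : ∀ n {w} → rank w ≢ n → rootAt (suc n) w ≡ rootAt n w
    rootAt-old n {w} ≢ with rank w ≟ n
    ... | no _ = refl
    ... | yes e = contradiction e ≢

    rootAt-stable : ∀ n {w} → rank w < n → rootAt n w ≡ root w
    rootAt-stable (suc n) {w} lt with m≤n⇒m<n∨m≡n (≤-pred lt)
    ... | inj₂ refl = refl
    ... | inj₁ lt' = ≡-trans (rootAt-old n (<⇒≢ lt')) (rootAt-stable n lt')

    Par : V G → V G → Set
    Par x w = x ∈ select (root w) w

    par-kid : ∀ {x w} → Par x w → x ∈ kids w
    par-kid p = proj₁ (select-sound p)

    par-rank : ∀ {x w} → Par x w → rank w < rank x
    par-rank p = proj₁ (proj₂ (select-sound p))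

    -- The search in `rootAt` can find no vertex but `w`, since a kid has a single owner, and it
    -- does find `w`, since `rank w < rank x` means that the root of `w` is already final.
    root-par : ∀ {x w} → Par x w → root x ≡ root w
    root-par {x} {w} p = go (rank x) refl
      where
      go : ∀ n → rank x ≡ n → rootAt (suc n) x ≡ root w
      go n e with rank x ≟ n | any? (λ p → x ∈? select (rootAt n p) p) (nbrs x)
      ... | no ≢ | _ = contradiction e ≢
      ... | yes _ | yes a with find a
      ... | q , _ , x∈ with kids-disjoint (proj₁ (select-sound x∈)) (par-kid p)
      ... | refl = rootAt-stable n (subst (rank w <_) e (par-rank p))
      go n e | yes _ | no none = contradiction
        (lose (nbrs-complete (Graph.sym G (kids-adj (par-kid p))))
          (subst (λ r → x ∈ select r w) (≡-sym (rootAt-stable n (subst (rank w <_) e (par-rank p)))) p)) none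

    root-chain : ∀ {x r} → Star Par x r → root x ≡ root r
    root-chain ε = refl
    root-chain (p ◅ ps) = ≡-trans (root-par p) (root-chain ps)

    root-self : ∀ {r} → (∀ w → ¬ Par r w) → root r ≡ r
    root-self {r} none = go (rank r) refl
      where
      go : ∀ n → rank r ≡ n → rootAt (suc n) r ≡ r
      go n e with rank r ≟ n | any? (λ p → r ∈? select (rootAt n p) p) (nbrs r)
      ... | no ≢ | _ = contradiction e ≢
      ... | yes _ | no _ = refl
      ... | yes _ | yes a with find a
      ... | q , _ , r∈ = contradiction
        (subst (λ s → r ∈ select s q) (rootAt-stable n (subst (rank q <_) e (proj₁ (proj₂ (select-sound r∈))))) r∈) (none q)

    parent? : ∀ x → (∃ λ w → Par x w) ⊎ (∀ w → ¬ Par x w)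
    parent? x with any? (λ w → x ∈? select (root w) w) (nbrs x)
    ... | yes a = let w , _ , p = find a in inj₁ (w , p)
    ... | no none = inj₂ λ w p → none (lose (nbrs-complete (Graph.sym G (kids-adj (par-kid p)))) p)

    children : ∀ w → Σ (List (V G)) λ ns → length ns ≡ Δ × Unique ns × (∀ x → Par x w ⇔ (x ∈ ns))
    children w = select (root w) w
      , ≡-trans (length-take Δ _) (m≤n⇒m⊓n≡m (many-good (root w) w))
      , take⁺ Δ (filter⁺ (good? (root w) w) (kids-unique w))
      , λ x → mk⇔ id id

    par-induced : ∀ {x y p q} → Par x p → Par y q → Adj G x y → Par x y ⊎ Par y x
    par-induced xp yq xy with kids-induced (par-kid xp) (par-kid yq) xy
    ... | inj₁ refl = inj₁ xp
    ... | inj₂ refl = inj₂ yq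

    -- The root of `p` computed by `rootAt` is `r`, so `Good` leaves two cases: `p` is `r`, or `x`
    -- is not adjacent to `r`.
    root-induced : ∀ {x p r} → Par x p → Star Par x r → (∀ w → ¬ Par r w) → Adj G x r → Par x r
    root-induced {x} {p} {r} xp c none xr with proj₂ (proj₂ (select-sound xp))
    ... | inj₁ e = subst (Par x) (≡-trans (≡-sym e) p-root) xp
      where
      p-root : root p ≡ r
      p-root = ≡-trans (≡-sym (root-par xp)) (≡-trans (root-chain c) (root-self none))
    ... | inj₂ ¬a = contradiction (subst (Adj G x)
        (≡-sym (≡-trans (≡-sym (root-par xp)) (≡-trans (root-chain c) (root-self none)))) xr) ¬a

    open RootedForest G Δ Par (λ p q → kids-disjoint (par-kid p) (par-kid q)) (λ p → kids-adj (par-kid p))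
      rank par-rank parent? children par-induced root-induced
      using (forest; delta-ary; componentwise-induced; delete-roots) public

  -- Orienting a sparse graph

  -- Pairs of sum `s` get values from `s * s` to `s * s + s`, below the next square; so the value
  -- determines the sum and then `a`.
  pairing : ℕ → ℕ → ℕ
  pairing a b = (a + b) * (a + b) + a

  pairing-sum : ∀ a b a' b' → a + b < a' + b' → pairing a b < pairing a' b'
  pairing-sum a b a' b' lt = begin-strict
    s * s + a <⟨ s≤s (+-monoʳ-≤ (s * s) (m≤m+n a b)) ⟩
    suc (s * s + s) ≤⟨ m≤m+n _ s ⟩
    suc (s * s + s) + s ≡⟨ square s ⟩
    suc s * suc s ≤⟨ *-mono-≤ lt lt ⟩
    (a' + b') * (a' + b') ≤⟨ m≤m+n _ a' ⟩
    pairing a' b' ∎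
    where
    open ≤-Reasoning
    s = a + b
    square : ∀ s → suc (s * s + s) + s ≡ suc s * suc s
    square = solve-∀

  pairing-injective : ∀ {a b a' b'} → pairing a b ≡ pairing a' b' → a ≡ a' × b ≡ b'
  pairing-injective {a} {b} {a'} {b'} e = a≡a' , +-cancelˡ-≡ a b b' (≡-trans sums (cong (_+ b') (≡-sym a≡a')))
    where
    sums : a + b ≡ a' + b'
    sums = ≤-antisym (≮⇒≥ λ lt → <-irrefl (≡-sym e) (pairing-sum a' b' a b lt))
                     (≮⇒≥ λ lt → <-irrefl e (pairing-sum a b a' b' lt))
    a≡a' : a ≡ a'
    a≡a' = +-cancelˡ-≡ ((a + b) * (a + b)) a a' (≡-trans e (cong (λ s → s * s + a') (≡-sym sums)))

  module Sparse
    (G : Graph) (d : ℕ) (regular : Regular G d)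
    (expanding : ∀ X k → FiniteNonempty G X → EdgeBoundary G X k → d * length X ≤ k + 3 * length X)
    where

    _≟V_ : DecidableEquality (V G)
    u ≟V v = map′ (code-inj G) (cong (code G)) (code G u ≟ code G v)

    open DecMembership _≟V_ using (_∈?_)

    nbrs : V G → List (V G)
    nbrs v = proj₁ (regular v)

    nbrs-length : ∀ v → length (nbrs v) ≡ d
    nbrs-length v = proj₁ (proj₂ (regular v))

    nbrs-unique : ∀ v → Unique (nbrs v)
    nbrs-unique v = proj₁ (proj₂ (proj₂ (regular v)))

    nbrs-complete : ∀ {v w} → Adj G v w → w ∈ nbrs v
    nbrs-complete {v} {w} = Equivalence.to (proj₂ (proj₂ (proj₂ (regular v))) w)

    nbrs-sound : ∀ {v w} → w ∈ nbrs v → Adj G v w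
    nbrs-sound {v} {w} = Equivalence.from (proj₂ (proj₂ (proj₂ (regular v))) w)

    adj? : ∀ u v → Dec (Adj G u v)
    adj? u v = map′ nbrs-sound nbrs-complete (v ∈? nbrs u)

    arcs : List (V G) → List (V G × V G)
    arcs = concatMap λ x → map (x ,_) (nbrs x)

    arcs-length : ∀ X → length (arcs X) ≡ d * length X
    arcs-length [] = ≡-sym (*-zeroʳ d)
    arcs-length (x ∷ X) = ≡-trans (length-++ (map (x ,_) (nbrs x))) (≡-trans
      (cong₂ _+_ (≡-trans (length-map (x ,_) (nbrs x)) (nbrs-length x)) (arcs-length X)) (≡-sym (*-suc d (length X))))

    arcs-unique : ∀ X → Unique X → Unique (arcs X)
    arcs-unique X u = concatMap-unique _ X u (λ {x} _ → map⁺ (λ { refl → refl }) (nbrs-unique x)) same-tail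
      where
      same-tail : ∀ {x x' e} → e ∈ map (x ,_) (nbrs x) → e ∈ map (x' ,_) (nbrs x') → x ≡ x'
      same-tail {x} {x'} p q with ∈-map⁻ (x ,_) p | ∈-map⁻ (x' ,_) q
      ... | _ , _ , refl | _ , _ , refl = refl

    arcs-complete : ∀ {X x y} → x ∈ X → Adj G x y → (x , y) ∈ arcs X
    arcs-complete {x = x} x∈ a = ∈-concatMap (λ x → map (x ,_) (nbrs x)) x∈ (∈-map⁺ (x ,_) (nbrs-complete a))

    arcs-sound : ∀ X {x y} → (x , y) ∈ arcs X → x ∈ X × Adj G x y
    arcs-sound X e∈ with ∈-concatMap-find (λ x → map (x ,_) (nbrs x)) X e∈
    ... | x , x∈ , e∈' with ∈-map⁻ (x ,_) e∈'
    ... | _ , y∈ , refl = x∈ , nbrs-sound y∈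

    -- Of the `d * length X` arcs that start in `X`, all but `3 * length X` must leave it. The pairs
    -- are ordered, so an edge counts twice.
    sparse : ∀ X P → Unique X → Unique P → (∀ {x y} → (x , y) ∈ P → x ∈ X × y ∈ X × Adj G x y) →
      length P ≤ 3 * length X
    sparse [] [] _ _ _ = z≤n
    sparse [] (_ ∷ _) _ _ inside = contradiction (proj₁ (inside (here refl))) λ ()
    sparse X@(_ ∷ _) P uX uP inside = begin
      length P ≤⟨ length-⊆ P inner uP (λ e∈ → let x∈ , y∈ , a = inside e∈ in ∈-filter⁺ in? (arcs-complete x∈ a) y∈) ⟩
      length inner ≤⟨ +-cancelˡ-≤ (length outer) _ _ (begin
        length outer + length inner ≡⟨ +-comm (length outer) _ ⟩
        length inner + length outer ≡⟨ ≡-sym (length-split in? (arcs X)) ⟩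
        length (arcs X) ≡⟨ arcs-length X ⟩
        d * length X ≤⟨ expanding X (length outer) (uX , s≤s z≤n) boundary ⟩
        length outer + 3 * length X ∎) ⟩
      3 * length X ∎
      where
      open ≤-Reasoning
      in? : Decidable (λ e → proj₂ e ∈ X)
      in? e = proj₂ e ∈? X
      inner = filter in? (arcs X)
      outer = filter (¬? ∘ in?) (arcs X)
      boundary : EdgeBoundary G X (length outer)
      boundary = outer , refl , filter⁺ (¬? ∘ in?) (arcs-unique X uX) , λ x w → mk⇔
        (λ e∈ → let p , w∉ = ∈-filter⁻ (¬? ∘ in?) {xs = arcs X} e∈ ; x∈ , a = arcs-sound X p in x∈ , w∉ , a)
        (λ { (x∈ , w∉ , a) → ∈-filter⁺ (¬? ∘ in?) (arcs-complete x∈ a) w∉ })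

  -- Demands, slots and the kid relation

  module Kids
    (G : Graph) (d : ℕ) (regular : Regular G d)
    (expanding : ∀ X k → FiniteNonempty G X → EdgeBoundary G X k → d * length X ≤ k + 3 * length X)
    (K : ℕ) (K-small : 12 * K + 3 ≤ d)
    where

    open Sparse G d regular expanding public

    -- An edge, listed from its endpoint of smaller code, or the i-th request of a vertex
    -- to reserve one of its neighbours.
    Demand : Set
    Demand = (V G × V G) ⊎ (V G × Fin K)

    Slot : Set
    Slot = V G × Bool

    _≟D_ : DecidableEquality Demand
    _≟D_ = sum-≡-dec (pair-≡-dec _≟V_ _≟V_) (pair-≡-dec _≟V_ _≟ᶠ_)

    _≟S_ : DecidableEquality Slot
    _≟S_ = pair-≡-dec _≟V_ _≟ᵇ_

    number : Demand → ℕ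
    number (inj₁ (u , v)) = 2 * pairing (code G u) (code G v)
    number (inj₂ (w , i)) = suc (2 * pairing (code G w) (toℕ i))

    number-injective : ∀ {l l'} → number l ≡ number l' → l ≡ l'
    number-injective {inj₁ (u , v)} {inj₁ (u' , v')} e
      with pairing-injective {code G u} {code G v} (*-cancelˡ-≡ _ _ 2 e)
    ... | p , q = cong₂ (λ u v → inj₁ (u , v)) (code-inj G p) (code-inj G q)
    number-injective {inj₁ (u , v)} {inj₂ (w , i)} e =
      contradiction e (even≢odd (pairing (code G u) (code G v)) (pairing (code G w) (toℕ i)))
    number-injective {inj₂ (w , i)} {inj₁ (u , v)} e =
      contradiction (≡-sym e) (even≢odd (pairing (code G u) (code G v)) (pairing (code G w) (toℕ i)))
    number-injective {inj₂ (w , i)} {inj₂ (w' , i')} e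
      with pairing-injective {code G w} {toℕ i} (*-cancelˡ-≡ _ _ 2 (suc-injective e))
    ... | p , q = cong₂ (λ u v → inj₂ (u , v)) (code-inj G p) (toℕ-injective q)

    Dom : Demand → Set
    Dom (inj₁ (u , v)) = Adj G u v × code G u < code G v
    Dom (inj₂ _) = ⊤

    dom? : Decidable Dom
    dom? (inj₁ (u , v)) = adj? u v ×-dec (code G u <? code G v)
    dom? (inj₂ _) = yes tt

    slots : V G → List Slot
    slots v = (v , true) ∷ (v , false) ∷ []

    ∈-slots : ∀ v b → (v , b) ∈ slots v
    ∈-slots v true = here refl
    ∈-slots v false = there (here refl)

    slots-vertex : ∀ {r v} → r ∈ slots v → proj₁ r ≡ v
    slots-vertex (here refl) = refl
    slots-vertex (there (here refl)) = refl

    nb : Demand → List Slot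
    nb (inj₁ (u , v)) = slots u ++ slots v
    nb (inj₂ (w , _)) = concatMap slots (nbrs w)

    ends : V G → V G → V G × V G
    ends x w with code G x <? code G w
    ... | yes _ = x , w
    ... | no _ = w , x

    edge : V G → V G → Demand
    edge x w = inj₁ (ends x w)

    ends-< : ∀ {x w} → code G x < code G w → ends x w ≡ (x , w)
    ends-< {x} {w} lt with code G x <? code G w
    ... | yes _ = refl
    ... | no ≮ = contradiction lt ≮

    ends-≮ : ∀ {x w} → ¬ code G x < code G w → ends x w ≡ (w , x)
    ends-≮ {x} {w} ≮ with code G x <? code G w
    ... | yes lt = contradiction lt ≮
    ... | no _ = refl

    ends-cases : ∀ x w → (code G x < code G w × ends x w ≡ (x , w)) ⊎ (¬ code G x < code G w × ends x w ≡ (w , x))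
    ends-cases x w with code G x <? code G w
    ... | yes lt = inj₁ (lt , refl)
    ... | no ≮ = inj₂ (≮ , refl)

    ends-comm : ∀ x w → ends x w ≡ ends w x
    ends-comm x w with ends-cases x w | ends-cases w x
    ... | inj₁ (lt , _) | inj₁ (gt , _) = contradiction gt (<-asym lt)
    ... | inj₁ (_ , e) | inj₂ (_ , e') = ≡-trans e (≡-sym e')
    ... | inj₂ (_ , e) | inj₁ (_ , e') = ≡-trans e (≡-sym e')
    ... | inj₂ (p , e) | inj₂ (q , e') with code-inj G (≤-antisym (≮⇒≥ q) (≮⇒≥ p))
    ... | refl = refl

    ends-injective : ∀ {x w w'} → ends x w ≡ ends x w' → w ≡ w'
    ends-injective {x} {w} {w'} e with ends-cases x w | ends-cases x w'
    ... | inj₁ (_ , p) | inj₁ (_ , q) = cong proj₂ (≡-trans (≡-sym p) (≡-trans e q))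
    ... | inj₂ (_ , p) | inj₂ (_ , q) = cong proj₁ (≡-trans (≡-sym p) (≡-trans e q))
    ... | inj₁ (_ , p) | inj₂ (_ , q) with ≡-trans (≡-sym p) (≡-trans e q)
    ... | refl = refl
    ends-injective {x} {w} {w'} e | inj₂ (_ , p) | inj₁ (_ , q) with ≡-trans (≡-sym p) (≡-trans e q)
    ... | refl = refl

    edge-injective : ∀ {x w w'} → edge x w ≡ edge x w' → w ≡ w'
    edge-injective e = ends-injective (inj₁-injective e)

    edge-comm : ∀ x w → edge x w ≡ edge w x
    edge-comm x w = cong inj₁ (ends-comm x w)

    edge-dom : ∀ {x w} → Adj G x w → Dom (edge x w)
    edge-dom {x} {w} a with ends-cases x w
    ... | inj₁ (lt , e) = subst (Dom ∘ inj₁) (≡-sym e) (a , lt)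
    ... | inj₂ (≮ , e) = subst (Dom ∘ inj₁) (≡-sym e)
          (Graph.sym G a , ≤∧≢⇒< (≮⇒≥ ≮) λ c → irrefl G (subst (Adj G x) (code-inj G c) a))

    edge-nb : ∀ {x w r} → r ∈ nb (edge x w) → proj₁ r ≡ x ⊎ proj₁ r ≡ w
    edge-nb {x} {w} r∈ with ends-cases x w
    ... | inj₁ (_ , e) with ∈-++⁻ (slots x) (subst (λ p → _ ∈ nb (inj₁ p)) e r∈)
    ... | inj₁ p = inj₁ (slots-vertex p)
    ... | inj₂ p = inj₂ (slots-vertex p)
    edge-nb {x} {w} r∈ | inj₂ (_ , e) with ∈-++⁻ (slots w) (subst (λ p → _ ∈ nb (inj₁ p)) e r∈)
    ... | inj₁ p = inj₂ (slots-vertex p)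
    ... | inj₂ p = inj₁ (slots-vertex p)

    requests : V G → List Demand
    requests w = map (λ i → inj₂ (w , i)) (allFin K)

    edges : V G → List Demand
    edges x = map (edge x) (nbrs x)

    inv : Slot → List Demand
    inv (x , _) = edges x ++ concatMap requests (nbrs x)

    edge-∈-inv : ∀ {x w} b → Adj G x w → edge x w ∈ inv (x , b)
    edge-∈-inv {x} b a = ∈-++⁺ˡ {xs = edges x} (∈-map⁺ (edge x) (nbrs-complete a))

    inv-complete : ∀ {l r} → Dom l → r ∈ nb l → l ∈ inv r
    inv-complete {inj₁ (u , v)} {x , b} (a , lt) r∈ with ∈-++⁻ (slots u) r∈
    ... | inj₁ p = subst₂ (λ e y → inj₁ e ∈ inv (y , b)) (ends-< lt) (≡-sym (slots-vertex p)) (edge-∈-inv b a)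
    ... | inj₂ p = subst₂ (λ e y → inj₁ e ∈ inv (y , b)) (ends-≮ (<-asym lt)) (≡-sym (slots-vertex p)) (edge-∈-inv b (Graph.sym G a))
    inv-complete {inj₂ (w , i)} {x , b} _ r∈ with ∈-concatMap-find slots (nbrs w) r∈
    ... | y , y∈ , p = ∈-++⁺ʳ (edges x) (∈-concatMap requests
            (nbrs-complete (subst (λ z → Adj G z w) (≡-sym (slots-vertex p)) (Graph.sym G (nbrs-sound y∈))))
            (∈-map⁺ (λ i → inj₂ (w , i)) (∈-allFin i)))

    edgesOf : List Demand → List (V G × V G)
    edgesOf [] = []
    edgesOf (inj₁ e ∷ X) = e ∷ edgesOf X
    edgesOf (inj₂ _ ∷ X) = edgesOf X

    requestsOf : List Demand → List (V G × Fin K)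
    requestsOf [] = []
    requestsOf (inj₁ _ ∷ X) = requestsOf X
    requestsOf (inj₂ r ∷ X) = r ∷ requestsOf X

    length-demands : ∀ X → length X ≡ length (edgesOf X) + length (requestsOf X)
    length-demands [] = refl
    length-demands (inj₁ _ ∷ X) = cong suc (length-demands X)
    length-demands (inj₂ _ ∷ X) = ≡-trans (cong suc (length-demands X)) (≡-sym (+-suc (length (edgesOf X)) _))

    edgesOf-sound : ∀ X {e} → e ∈ edgesOf X → inj₁ e ∈ X
    edgesOf-sound (inj₁ _ ∷ X) (here refl) = here refl
    edgesOf-sound (inj₁ _ ∷ X) (there p) = there (edgesOf-sound X p)
    edgesOf-sound (inj₂ _ ∷ X) p = there (edgesOf-sound X p)

    requestsOf-sound : ∀ X {r} → r ∈ requestsOf X → inj₂ r ∈ X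
    requestsOf-sound (inj₂ _ ∷ X) (here refl) = here refl
    requestsOf-sound (inj₂ _ ∷ X) (there p) = there (requestsOf-sound X p)
    requestsOf-sound (inj₁ _ ∷ X) p = there (requestsOf-sound X p)

    edgesOf-unique : ∀ X → Unique X → Unique (edgesOf X)
    edgesOf-unique [] [] = []
    edgesOf-unique (inj₁ _ ∷ X) (x∉ ∷ u) =
      All.tabulate (λ { e∈ refl → All.lookup x∉ (edgesOf-sound X e∈) refl }) ∷ edgesOf-unique X u
    edgesOf-unique (inj₂ _ ∷ X) (_ ∷ u) = edgesOf-unique X u

    requestsOf-unique : ∀ X → Unique X → Unique (requestsOf X)
    requestsOf-unique [] [] = []
    requestsOf-unique (inj₂ _ ∷ X) (x∉ ∷ u) =
      All.tabulate (λ { e∈ refl → All.lookup x∉ (requestsOf-sound X e∈) refl }) ∷ requestsOf-unique X u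
    requestsOf-unique (inj₁ _ ∷ X) (_ ∷ u) = requestsOf-unique X u

    module Expansion (X : List Demand) (Y : List Slot) (X-unique : Unique X) (X-dom : All Dom X)
      (covers : ∀ {l r} → l ∈ X → r ∈ nb l → r ∈ Y) where

      open DecMembership _≟S_ using () renaming (_∈?_ to _∈S?_)

      saturated? : Decidable (λ v → (v , true) ∈ Y × (v , false) ∈ Y)
      saturated? v = ((v , true) ∈S? Y) ×-dec ((v , false) ∈S? Y)

      -- A demand that may use one slot of a vertex may use both, so the vertices touched by demands
      -- in `X` all lie in `T`, and each accounts for two slots of `Y`.
      T : List (V G)
      T = filter saturated? (deduplicate _≟V_ (map proj₁ Y))

      T-unique : Unique T
      T-unique = filter⁺ saturated? (deduplicate-! _≟V_ (map proj₁ Y))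

      T-complete : ∀ {v} → (∀ b → (v , b) ∈ Y) → v ∈ T
      T-complete h = ∈-filter⁺ saturated? (∈-deduplicate⁺ _≟V_ (∈-map⁺ proj₁ (h true))) (h true , h false)

      T-sound : ∀ {v b} → v ∈ T → (v , b) ∈ Y
      T-sound {b = true} v∈ = proj₁ (proj₂ (∈-filter⁻ saturated? {xs = deduplicate _≟V_ (map proj₁ Y)} v∈))
      T-sound {b = false} v∈ = proj₂ (proj₂ (∈-filter⁻ saturated? {xs = deduplicate _≟V_ (map proj₁ Y)} v∈))

      slots-length : ∀ vs → length (concatMap slots vs) ≡ 2 * length vs
      slots-length [] = refl
      slots-length (v ∷ vs) = ≡-trans (cong (2 +_) (slots-length vs)) (≡-sym (*-suc 2 (length vs)))

      slots-unique : ∀ v → Unique (slots v)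
      slots-unique v = ((λ ()) ∷ []) ∷ ([] ∷ [])

      T-bound : 2 * length T ≤ length Y
      T-bound = subst (_≤ length Y) (slots-length T) (length-⊆ _ Y
        (concatMap-unique slots T T-unique (λ {v} _ → slots-unique v)
          (λ p q → ≡-trans (≡-sym (slots-vertex p)) (slots-vertex q)))
        λ r∈ → let v , v∈ , r∈' = ∈-concatMap-find slots T r∈ in
          subst (λ w → (w , _) ∈ Y) (≡-sym (slots-vertex r∈')) (T-sound v∈))

      es = edgesOf X
      rs = requestsOf X

      edge-info : ∀ {u v} → (u , v) ∈ es → u ∈ T × v ∈ T × Adj G u v × code G u < code G v
      edge-info {u} {v} e∈ =
        T-complete (λ b → covers (edgesOf-sound X e∈) (∈-++⁺ˡ (∈-slots u b))) ,
        T-complete (λ b → covers (edgesOf-sound X e∈) (∈-++⁺ʳ (slots u) (∈-slots v b))) ,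
        All.lookup X-dom (edgesOf-sound X e∈)

      -- Each edge is entered together with its reversal to match the ordered pairs of `sparse`; the
      -- order of codes keeps the two lists disjoint.
      edges-bound : 2 * length es ≤ 3 * length T
      edges-bound = begin
        2 * length es ≡⟨ cong (length es +_) (+-identityʳ (length es)) ⟩
        length es + length es ≡⟨ cong (length es +_) (≡-sym (length-map swap es)) ⟩
        length es + length (map swap es) ≡⟨ ≡-sym (length-++ es) ⟩
        length (es ++ map swap es) ≤⟨ sparse T (es ++ map swap es) T-unique
          (++⁺ (edgesOf-unique X X-unique) (map⁺ (λ { refl → refl }) (edgesOf-unique X X-unique)) apart) inside ⟩
        3 * length T ∎
        where
        open ≤-Reasoning
        apart : ∀ {e} → ¬ (e ∈ es × e ∈ map swap es)
        apart (p , q) with ∈-map⁻ swap q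
        ... | _ , q' , refl = <-asym (proj₂ (proj₂ (proj₂ (edge-info p)))) (proj₂ (proj₂ (proj₂ (edge-info q'))))
        inside : ∀ {x y} → (x , y) ∈ es ++ map swap es → x ∈ T × y ∈ T × Adj G x y
        inside e∈ with ∈-++⁻ es e∈
        ... | inj₁ p = let x∈ , y∈ , a , _ = edge-info p in x∈ , y∈ , a
        ... | inj₂ q with ∈-map⁻ swap q
        ... | _ , q' , refl = let x∈ , y∈ , a , _ = edge-info q' in y∈ , x∈ , Graph.sym G a

      W : List (V G)
      W = deduplicate _≟V_ (map proj₁ rs)

      W-unique : Unique W
      W-unique = deduplicate-! _≟V_ (map proj₁ rs)

      W-nbrs : ∀ {w x} → w ∈ W → Adj G w x → x ∈ T
      W-nbrs w∈ a with ∈-map⁻ proj₁ (∈-deduplicate⁻ _≟V_ (map proj₁ rs) w∈)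
      ... | _ , r∈ , refl = T-complete λ b →
        covers (requestsOf-sound X r∈) (∈-concatMap slots (nbrs-complete a) (∈-slots _ b))

      requests-bound : length rs ≤ K * length W
      requests-bound = begin
        length rs ≤⟨ length-⊆ rs (concatMap (λ w → map (w ,_) (allFin K)) W) (requestsOf-unique X X-unique)
          (λ {r} r∈ → ∈-concatMap (λ w → map (w ,_) (allFin K))
            (∈-deduplicate⁺ _≟V_ (∈-map⁺ proj₁ r∈)) (∈-map⁺ (proj₁ r ,_) (∈-allFin (proj₂ r)))) ⟩
        length (concatMap (λ w → map (w ,_) (allFin K)) W) ≡⟨ grid W ⟩
        K * length W ∎
        where
        open ≤-Reasoning
        grid : ∀ ws → length (concatMap (λ w → map (w ,_) (allFin K)) ws) ≡ K * length ws
        grid [] = ≡-sym (*-zeroʳ K)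
        grid (w ∷ ws) = ≡-trans (length-++ (map (w ,_) (allFin K))) (≡-trans
          (cong₂ _+_ (≡-trans (length-map (w ,_) (allFin K)) (length-tabulate {n = K} (λ i → i))) (grid ws)) (≡-sym (*-suc K (length ws))))

      -- All `d` arcs out of each requester stay inside `W ++ T`, so `sparse` bounds them by three
      -- times its size. The 3 in `K-small` pays for the share of `W`, and the 12 makes the requests
      -- at most a quarter of `length T`.
      requesters-bound : 12 * K * length W ≤ 3 * length T
      requesters-bound = +-cancelʳ-≤ (3 * length W) _ _ (begin
        12 * K * length W + 3 * length W ≡⟨ ≡-sym (*-distribʳ-+ (length W) (12 * K) 3) ⟩
        (12 * K + 3) * length W ≤⟨ *-monoˡ-≤ (length W) K-small ⟩
        d * length W ≡⟨ ≡-sym (arcs-length W) ⟩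
        length (arcs W) ≤⟨ sparse U (arcs W) (deduplicate-! _≟V_ (W ++ T)) (arcs-unique W W-unique) inside ⟩
        3 * length U ≤⟨ *-monoʳ-≤ 3 (length-⊆ U (W ++ T) (deduplicate-! _≟V_ (W ++ T)) (∈-deduplicate⁻ _≟V_ (W ++ T))) ⟩
        3 * length (W ++ T) ≡⟨ cong (3 *_) (length-++ W) ⟩
        3 * (length W + length T) ≡⟨ *-distribˡ-+ 3 (length W) _ ⟩
        3 * length W + 3 * length T ≡⟨ +-comm (3 * length W) _ ⟩
        3 * length T + 3 * length W ∎)
        where
        open ≤-Reasoning
        U = deduplicate _≟V_ (W ++ T)
        inside : ∀ {x y} → (x , y) ∈ arcs W → x ∈ U × y ∈ U × Adj G x y
        inside e∈ with arcs-sound W e∈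
        ... | x∈ , a = ∈-deduplicate⁺ _≟V_ (∈-++⁺ˡ x∈) , ∈-deduplicate⁺ _≟V_ (∈-++⁺ʳ W (W-nbrs x∈ a)) , a

      -- Edges number at most 3/2 and requests at most 1/4 of `length T`; together this is 7/4 of
      -- `length T`, hence 7/8 of `length Y`.
      expansion : 8 * length X ≤ 7 * length Y
      expansion = *-cancelˡ-≤ 3 (begin
        3 * (8 * length X) ≡⟨ cong (λ n → 3 * (8 * n)) (length-demands X) ⟩
        3 * (8 * (length es + length rs)) ≤⟨ *-monoʳ-≤ 3 (*-monoʳ-≤ 8 (+-monoʳ-≤ (length es) requests-bound)) ⟩
        3 * (8 * (length es + K * length W)) ≡⟨ arrange₁ (length es) K (length W) ⟩
        12 * (2 * length es) + 2 * (12 * K * length W) ≤⟨ +-mono-≤ (*-monoʳ-≤ 12 edges-bound) (*-monoʳ-≤ 2 requesters-bound) ⟩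
        12 * (3 * length T) + 2 * (3 * length T) ≡⟨ arrange₂ (length T) ⟩
        3 * (7 * (2 * length T)) ≤⟨ *-monoʳ-≤ 3 (*-monoʳ-≤ 7 T-bound) ⟩
        3 * (7 * length Y) ∎)
        where
        open ≤-Reasoning
        arrange₁ : ∀ e k w → 3 * (8 * (e + k * w)) ≡ 12 * (2 * e) + 2 * (12 * k * w)
        arrange₁ = solve-∀
        arrange₂ : ∀ t → 12 * (3 * t) + 2 * (3 * t) ≡ 3 * (7 * (2 * t))
        arrange₂ = solve-∀

    module Reserved
      (f : Demand → Maybe Slot)
      (f-sound : ∀ {l r} → f l ≡ just r → r ∈ nb l)
      (f-total : ∀ {l} → Dom l → ∃ λ r → f l ≡ just r)
      (f-injective : ∀ {l l' r} → f l ≡ just r → f l' ≡ just r → l ≡ l')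
      where

      At : Demand → V G → Set
      At l x = ∃ λ b → f l ≡ just (x , b)

      at? : ∀ l x → Dec (At l x)
      at? l x = map′ (λ { (inj₁ e) → true , e ; (inj₂ e) → false , e })
        (λ { (true , e) → inj₁ e ; (false , e) → inj₂ e })
        (maybe-≡-dec _≟S_ (f l) (just (x , true)) ⊎-dec maybe-≡-dec _≟S_ (f l) (just (x , false)))

      two-slots : (a b c : Bool) → a ≡ b ⊎ c ≡ a ⊎ c ≡ b
      two-slots true true _ = inj₁ refl
      two-slots false false _ = inj₁ refl
      two-slots true false true = inj₂ (inj₁ refl)
      two-slots true false false = inj₂ (inj₂ refl)
      two-slots false true true = inj₂ (inj₂ refl)
      two-slots false true false = inj₂ (inj₁ refl)

      -- A vertex has only two slots, so two distinct demands at `x` leave no room for a third.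
      full : ∀ {l l' l'' x} → l ≢ l' → At l x → At l' x → At l'' x → l'' ≡ l ⊎ l'' ≡ l'
      full l≢l' (a , p) (b , q) (c , s) with two-slots a b c
      ... | inj₁ refl = contradiction (f-injective p q) l≢l'
      ... | inj₂ (inj₁ refl) = inj₁ (f-injective s p)
      ... | inj₂ (inj₂ refl) = inj₂ (f-injective s q)

      Reserves : V G → V G → Set
      Reserves w x = At (edge x w) x × ∃ λ i → At (inj₂ (w , i)) x

      reserves? : ∀ w → Decidable (Reserves w)
      reserves? w x = at? (edge x w) x ×-dec anyFin? λ i → at? (inj₂ (w , i)) x

      -- Both slots of a kid x of w are occupied by demands of w, so x owns no edge other than xw.
      kids : V G → List (V G)
      kids w = filter (reserves? w) (nbrs w)

      kids-unique : ∀ w → Unique (kids w)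
      kids-unique w = filter⁺ (reserves? w) (nbrs-unique w)

      kids-reserve : ∀ {x w} → x ∈ kids w → Reserves w x
      kids-reserve {x} {w} x∈ = proj₂ (∈-filter⁻ (reserves? w) {xs = nbrs w} x∈)

      kids-adj : ∀ {x w} → x ∈ kids w → Adj G w x
      kids-adj {x} {w} x∈ = nbrs-sound (proj₁ (∈-filter⁻ (reserves? w) {xs = nbrs w} x∈))

      owned-edge : ∀ {x w y} → Reserves w x → At (edge x y) x → y ≡ w
      owned-edge {x} {w} {y} (e , i , r) e' with full {edge x w} {inj₂ (w , i)} (λ ()) e r e'
      ... | inj₁ eq = edge-injective eq

      kids-disjoint : ∀ {x w w'} → x ∈ kids w → x ∈ kids w' → w ≡ w'
      kids-disjoint p q = ≡-sym (owned-edge (kids-reserve p) (proj₁ (kids-reserve q)))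

      edge-at : ∀ {x y} → Adj G x y → At (edge x y) x ⊎ At (edge x y) y
      edge-at {x} {y} a with f-total (edge-dom a)
      ... | (z , b) , e with edge-nb {x} {y} (f-sound e)
      ... | inj₁ refl = inj₁ (b , e)
      ... | inj₂ refl = inj₂ (b , e)

      kids-induced : ∀ {x y w z} → x ∈ kids w → y ∈ kids z → Adj G x y → y ≡ w ⊎ x ≡ z
      kids-induced {x} {y} p q a with edge-at a
      ... | inj₁ e = inj₁ (owned-edge (kids-reserve p) e)
      ... | inj₂ e = inj₂ (owned-edge (kids-reserve q) (subst (λ l → At l y) (edge-comm x y) e))

      -- A kid `x` of `w` holds no edge but the one to `w`, so the edge from `x` to `r` must sit at
      -- `r`, where there are two slots.
      kids-sparse : ∀ w r → r ≢ w → length (filter (λ x → adj? x r) (kids w)) ≤ 2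
      kids-sparse w r r≢w = length-injection (λ x b → f (edge x r) ≡ just (r , b))
        (λ {x} {x'} e e' → edge-injective (≡-trans (edge-comm r x) (≡-trans (f-injective e e') (edge-comm x' r))))
        _ (true ∷ false ∷ []) (filter⁺ (λ x → adj? x r) (kids-unique w)) owned-by-r
        where
        owned-by-r : ∀ {x} → x ∈ filter (λ x → adj? x r) (kids w) →
          ∃ λ b → b ∈ true ∷ false ∷ [] × f (edge x r) ≡ just (r , b)
        owned-by-r x∈ with ∈-filter⁻ (λ x → adj? x r) {xs = kids w} x∈
        ... | x∈' , a with edge-at a
        ... | inj₁ e = contradiction (owned-edge (kids-reserve x∈') e) r≢w
        ... | inj₂ (true , e) = true , here refl , e
        ... | inj₂ (false , e) = false , there (here refl) , e

      -- A request of `w` placed at `x` makes `x` a kid unless the edge `xw` sits at `w`. In that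
      -- case its slot `b'` at `w` determines the edge and so `x`, and the slot `b` at `x`
      -- determines the request: at most 2 * 2 requests are lost.
      kids-many : ∀ w → K ≤ length (kids w) + 4
      kids-many w = subst₂ _≤_ (length-tabulate {n = K} (λ i → i)) targets-length
        (length-injection Serves serves-injective (allFin K) targets (allFin⁺ K) λ {i} _ → serve i)
        where
        targets : List (V G ⊎ (Bool × Bool))
        targets = map inj₁ (kids w) ++ map inj₂ (cartesianProduct (true ∷ false ∷ []) (true ∷ false ∷ []))
        targets-length : length targets ≡ length (kids w) + 4
        targets-length = ≡-trans (length-++ (map inj₁ (kids w))) (cong (_+ 4) (length-map inj₁ (kids w)))
        ∈-bools : ∀ b → b ∈ true ∷ false ∷ []
        ∈-bools true = here refl
        ∈-bools false = there (here refl)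
        Serves : Fin K → V G ⊎ (Bool × Bool) → Set
        Serves i (inj₁ x) = At (inj₂ (w , i)) x × At (edge x w) x
        Serves i (inj₂ (b , b')) = ∃ λ x → f (inj₂ (w , i)) ≡ just (x , b) × f (edge x w) ≡ just (w , b')
        same-request : ∀ {i j} → _≡_ {A = Demand} (inj₂ (w , i)) (inj₂ (w , j)) → i ≡ j
        same-request refl = refl
        serves-injective : ∀ {i j y} → Serves i y → Serves j y → i ≡ j
        serves-injective {i} {j} {inj₁ x} (p , e) (q , _) with full {edge x w} {inj₂ (w , i)} (λ ()) e p q
        ... | inj₂ eq = ≡-sym (same-request eq)
        serves-injective {i} {j} {inj₂ _} (x , p , e) (x' , q , e')
          with edge-injective (≡-trans (edge-comm w x) (≡-trans (f-injective e e') (edge-comm x' w)))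
        ... | refl = same-request (f-injective p q)
        serve : ∀ i → ∃ λ y → y ∈ targets × Serves i y
        serve i with f-total {inj₂ (w , i)} tt
        ... | (x , b) , e with ∈-concatMap-find slots (nbrs w) (f-sound e)
        ... | x' , x'∈ , r∈ with slots-vertex r∈
        ... | refl with edge-at (Graph.sym G (nbrs-sound x'∈))
        ... | inj₁ at = inj₁ x , ∈-++⁺ˡ (∈-map⁺ inj₁ (∈-filter⁺ (reserves? w) x'∈ (at , i , b , e))) , (b , e) , at
        ... | inj₂ (b' , e') = inj₂ (b , b') , ∈-++⁺ʳ (map inj₁ (kids w))
                (∈-map⁺ inj₂ (∈-cartesianProduct⁺ (∈-bools b) (∈-bools b'))) , x , e , e'

  expanding⇒pseudoforest : (G : Graph) (d Δ : ℕ) → Regular G d → 1 ≤ Δ → 200 * Δ < d →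
    (∀ X k → FiniteNonempty G X → EdgeBoundary G X k → d * length X ≤ k + 3 * length X) →
    Σ (SpanningSubgraph G) λ F → DeltaAryPseudoforest (E F) Δ × ComponentwiseInduced G F ×
      DeleteOnePerComponentInducedForest G F
  expanding⇒pseudoforest G d Δ regular 1≤Δ Δ<d expanding =
    forest , delta-ary , componentwise-induced , delete-roots
    where
    open ≤-Reasoning
    K = Δ + 14
    K-small : 12 * K + 3 ≤ d
    -- Here 12 * 14 + 3 = 171, which `1 ≤ Δ` turns into a multiple of `Δ`; 12 + 171 = 183 is rounded
    -- up to 200.
    K-small = begin
      12 * (Δ + 14) + 3 ≡⟨ arrange₁ Δ ⟩
      12 * Δ + 171 * 1 ≤⟨ +-monoʳ-≤ (12 * Δ) (*-monoʳ-≤ 171 1≤Δ) ⟩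
      12 * Δ + 171 * Δ ≤⟨ m≤m+n _ (17 * Δ) ⟩
      12 * Δ + 171 * Δ + 17 * Δ ≡⟨ arrange₂ Δ ⟩
      200 * Δ ≤⟨ <⇒≤ Δ<d ⟩
      d ∎
      where
      arrange₁ : ∀ x → 12 * (x + 14) + 3 ≡ 12 * x + 171 * 1
      arrange₁ = solve-∀
      arrange₂ : ∀ x → 12 * x + 171 * x + 17 * x ≡ 200 * x
      arrange₂ = solve-∀
    open Kids G d regular expanding K K-small
    open ExpandingMatching _≟D_ _≟S_ number number-injective Dom dom? nb inv inv-complete 7 Expansion.expansion
      using (matched; matched-sound; matched-total; matched-injective)
    open Reserved matched (λ {l} → matched-sound {l}) (λ {l} → matched-total {l}) (λ {l} {l'} → matched-injective {l} {l'})
    open Ranking (code G) (code-inj G) kids kids-unique kids-disjoint using (rank; few-early-kids)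
    enough-kids : ∀ w → Δ + 10 ≤ length (kids w)
    enough-kids w = +-cancelʳ-≤ 4 _ _ (≤-trans (≤-reflexive (+-assoc Δ 10 4)) (kids-many w))
    open Selection G Δ _≟V_ adj? nbrs nbrs-complete kids kids-unique kids-adj kids-disjoint kids-induced
      kids-sparse enough-kids rank few-early-kids
      using (forest; delta-ary; componentwise-induced; delete-roots)

-- From rational hypotheses to inequalities of natural numbers

module Rationals where

  open import Data.Nat as ℕ using (ℕ; suc)
  import Data.Nat.Properties as ℕ
  open import Data.Integer as ℤ using (ℤ; +_)
  import Data.Integer.Properties as ℤ
  open import Data.Rational using (ℚ; 0ℚ; _/_; _+_; _-_; _*_; _<_; _≤_; -_; toℚᵘ; NonNegative)
  open import Data.Rational.Properties
  open import Data.Rational.Unnormalised as ℚᵘ using (mkℚᵘ)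
  import Data.Rational.Unnormalised.Properties as ℚᵘ
  open import Relation.Binary.PropositionalEquality using (_≡_; refl; cong; cong₂; subst₂) renaming (sym to ≡-sym; trans to ≡-trans)

  -- `fromℕ n` is normalised by a gcd that is stuck on a variable; among unnormalised rationals its
  -- denominator is plainly 1.
  toℚᵘ-fromℕ : ∀ n → toℚᵘ (fromℕ n) ℚᵘ.≃ mkℚᵘ (+ n) 0
  toℚᵘ-fromℕ n = toℚᵘ-fromℚᵘ (mkℚᵘ (+ n) 0)

  fromℕ-+ : ∀ a b → fromℕ (a ℕ.+ b) ≡ fromℕ a + fromℕ b
  fromℕ-+ a b = toℚᵘ-injective (begin
    toℚᵘ (fromℕ (a ℕ.+ b)) ≈⟨ toℚᵘ-fromℕ (a ℕ.+ b) ⟩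
    mkℚᵘ (+ (a ℕ.+ b)) 0 ≡⟨ cong (λ z → mkℚᵘ z 0) (cong₂ ℤ._+_ (≡-sym (ℤ.*-identityʳ (+ a))) (≡-sym (ℤ.*-identityʳ (+ b)))) ⟩
    mkℚᵘ (+ a) 0 ℚᵘ.+ mkℚᵘ (+ b) 0 ≈⟨ ℚᵘ.+-cong (toℚᵘ-fromℕ a) (toℚᵘ-fromℕ b) ⟨
    toℚᵘ (fromℕ a) ℚᵘ.+ toℚᵘ (fromℕ b) ≈⟨ toℚᵘ-homo-+ (fromℕ a) (fromℕ b) ⟨
    toℚᵘ (fromℕ a + fromℕ b) ∎)
    where open ℚᵘ.≃-Reasoning

  fromℕ-* : ∀ a b → fromℕ (a ℕ.* b) ≡ fromℕ a * fromℕ b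
  fromℕ-* a b = toℚᵘ-injective (begin
    toℚᵘ (fromℕ (a ℕ.* b)) ≈⟨ toℚᵘ-fromℕ (a ℕ.* b) ⟩
    mkℚᵘ (+ (a ℕ.* b)) 0 ≡⟨ cong (λ z → mkℚᵘ z 0) (ℤ.pos-* a b) ⟩
    mkℚᵘ (+ a) 0 ℚᵘ.* mkℚᵘ (+ b) 0 ≈⟨ ℚᵘ.*-cong (toℚᵘ-fromℕ a) (toℚᵘ-fromℕ b) ⟨
    toℚᵘ (fromℕ a) ℚᵘ.* toℚᵘ (fromℕ b) ≈⟨ toℚᵘ-homo-* (fromℕ a) (fromℕ b) ⟨
    toℚᵘ (fromℕ a * fromℕ b) ∎)
    where open ℚᵘ.≃-Reasoning

  fromℕ-cancel-≤ : ∀ {a b} → fromℕ a ≤ fromℕ b → a ℕ.≤ b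
  fromℕ-cancel-≤ {a} {b} le = ℤ.drop‿+≤+ (subst₂ ℤ._≤_ (ℤ.*-identityʳ (+ a)) (ℤ.*-identityʳ (+ b))
    (ℚᵘ.drop-*≤* (ℚᵘ.≤-respˡ-≃ (toℚᵘ-fromℕ a) (ℚᵘ.≤-respʳ-≃ (toℚᵘ-fromℕ b) (toℚᵘ-mono-≤ le)))))

  fromℕ-cancel-< : ∀ {a b} → fromℕ a < fromℕ b → a ℕ.< b
  fromℕ-cancel-< {a} {b} lt = ℤ.drop‿+<+ (subst₂ ℤ._<_ (ℤ.*-identityʳ (+ a)) (ℤ.*-identityʳ (+ b))
    (ℚᵘ.drop-*<* (ℚᵘ.<-respˡ-≃ (toℚᵘ-fromℕ a) (ℚᵘ.<-respʳ-≃ (toℚᵘ-fromℕ b) (toℚᵘ-mono-< lt)))))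

  fromℕ-nonNegative : ∀ n → NonNegative (fromℕ n)
  fromℕ-nonNegative n = normalize-nonNeg n 1

  threshold : ℚ
  threshold = + 1 / 200

  degree-large : ∀ {Δ d} → fromℕ Δ < threshold * fromℕ d → 200 ℕ.* Δ ℕ.< d
  degree-large {Δ} {d} lt = fromℕ-cancel-< (subst₂ _<_ (≡-sym (fromℕ-* 200 Δ)) scaled (*-monoʳ-<-pos (fromℕ 200) lt))
    where
    scaled : fromℕ 200 * (threshold * fromℕ d) ≡ fromℕ d
    -- `fromℕ 200 * threshold` is a product of closed terms and computes to 1.
    scaled = ≡-trans (≡-sym (*-assoc (fromℕ 200) threshold (fromℕ d))) (*-identityˡ (fromℕ d))

  -- The bound dominates d - 3 because `+ 1 / suc m` and `δ` are nonnegative; adding 3n to both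
  -- sides removes the subtraction, so the result can be read in the natural numbers.
  boundary-bound : ∀ {d m δ} n k → 0ℚ < δ →
    (((fromℕ d - fromℕ 3) + (+ 1 / suc m)) + δ) * fromℕ n ≤ fromℕ k → d ℕ.* n ℕ.≤ k ℕ.+ 3 ℕ.* n
  boundary-bound {d} {m} {δ} n k δ>0 h = fromℕ-cancel-≤ (begin
    fromℕ (d ℕ.* n) ≡⟨ fromℕ-* d n ⟩
    fromℕ d * N ≡⟨ cong (_* N) (≡-sym regroup) ⟩
    (c + fromℕ 3) * N ≡⟨ *-distribʳ-+ N c (fromℕ 3) ⟩
    c * N + fromℕ 3 * N ≤⟨ +-monoˡ-≤ (fromℕ 3 * N) (≤-trans (*-monoʳ-≤-nonNeg N {{fromℕ-nonNegative n}} slack) h) ⟩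
    fromℕ k + fromℕ 3 * N ≡⟨ cong (λ z → fromℕ k + z) (≡-sym (fromℕ-* 3 n)) ⟩
    fromℕ k + fromℕ (3 ℕ.* n) ≡⟨ ≡-sym (fromℕ-+ k (3 ℕ.* n)) ⟩
    fromℕ (k ℕ.+ 3 ℕ.* n) ∎)
    where
    open ≤-Reasoning
    N = fromℕ n
    c = fromℕ d - fromℕ 3
    regroup : c + fromℕ 3 ≡ fromℕ d
    regroup = ≡-trans (+-assoc (fromℕ d) (- fromℕ 3) (fromℕ 3)) (+-identityʳ (fromℕ d))
    slack : c ≤ (c + (+ 1 / suc m)) + δ
    slack = begin
      c ≡⟨ ≡-sym (≡-trans (+-identityʳ (c + 0ℚ)) (+-identityʳ c)) ⟩
      (c + 0ℚ) + 0ℚ ≤⟨ +-mono-≤ (+-monoʳ-≤ c (nonNegative⁻¹ (+ 1 / suc m) {{normalize-nonNeg 1 (suc m)}})) (<⇒≤ δ>0) ⟩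
      (c + (+ 1 / suc m)) + δ ∎

open import Data.Nat using (ℕ; suc; _≤_; _^_) renaming (_*_ to _*ℕ_)
open import Data.Integer using (+_)
open import Data.Rational using (ℚ; 0ℚ; _<_; _+_; _-_; _*_; _/_)
open import Data.List using (length)
open import Data.Product using (Σ; _×_; _,_)
open import Data.Rational.Properties using (positive⁻¹)

theorem1p8 : Σ ℚ (λ ε → (0ℚ < ε) × ((G : Graph) (d Δ : ℕ) → Regular G d → 1 ≤ Δ → fromℕ Δ < ε * fromℕ d → CheegerGreater G ((fromℕ d - fromℕ 3) + ((+ 1) / suc (10 ^ 7 *ℕ Δ))) → Σ (SpanningSubgraph G) (λ F → DeltaAryPseudoforest (E F) Δ × ComponentwiseInduced G F × DeleteOnePerComponentInducedForest G F)))
theorem1p8 = threshold , positive⁻¹ threshold , λ G d Δ regular 1≤Δ Δ<εd (δ , δ>0 , cheeger) →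
  expanding⇒pseudoforest G d Δ regular 1≤Δ (degree-large {Δ} {d} Δ<εd) λ X k nonempty boundary →
    boundary-bound {d} {10 ^ 7 *ℕ Δ} (length X) k δ>0 (cheeger X k nonempty boundary)
  where
  open Pseudoforests using (expanding⇒pseudoforest)
  open Rationals
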